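{- Let $\tau$ be a finite language and let $\mathbb{K}$ be a class of $\tau$-structures that is axiomatized by a computable $\bigwedge\!\!\bigwedge$-sentence (i.e. $\mathbb{K}$ is the class of models of such a sentence). Then $\mathbb{K}$ is a $\mathrm{PC}'$-class.
   Context: The $\bigwedge\!\!\bigwedge$-formulas are the infinitary $\mathcal{L}_{\omega_1\omega}$-formulas built from finitary quantifier-free formulas using $\exists$, $\forall$ and countable conjunctions $\bigwedge\!\!\bigwedge_{i\in\omega}$ (of formulas with finitely many free variables in total); no infinitary disjunctions. Computability is via formula codes: fixing a Gödel coding of atomic formulas, connectives and quantifiers, a labeled tree is a nonempty tree $T\subseteq\omega^{<\omega}$ with functions $l$ and $v$ such that each $\sigma\in T$ is either (a) a leaf with $l(\sigma)$ the code of a finite disjunction $\psi$ of atomic and negated atomic formulas and $\{x_i: i\in v(\sigma)\}$ the free variables of $\psi$; (b) $l(\sigma)=\ulcorner\exists x_i\urcorner$, $\sigma^\frown 0$ the unique child, $v(\sigma)=v(\sigma^\frown0)\setminus\{i\}$; (c) same with $\forall x_i$; (d) $l(\sigma)=\ulcorner\bigwedge\!\!\bigwedge\urcorner$ and $v(\sigma)=\bigcup_{\sigma^\frown i\in T}v(\sigma^\frown i)$ is finite; or (e) the same with $\bigvee\!\!\bigvee$. A formula code is a well-founded labeled tree; it codes a formula in the obvious way; it is a sentence code if $v(\varnothing)=\varnothing$. A computable $\bigwedge\!\!\bigwedge$-sentence is one with a sentence code $(T,l,v)$ with $T,l,v$ computable and no node labeled $\ulcorner\bigvee\!\!\bigvee\urcorner$.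 A class $\mathbb{K}$ of $\tau$-structures is a $\mathrm{PC}'$-class if there is a language $\tau^*\supseteq\tau$ containing a unary predicate $P\in\tau^*\setminus\tau$ and a single first-order $\tau^*$-sentence $\phi$ such that $\mathbb{K}=\{\mathcal{A}_P : \mathcal{A}\models\phi \text{ and } \mathcal{A}_P \text{ is defined}\}$, where $\mathcal{A}_P$ denotes the substructure of the reduct $\mathcal{A}|\tau$ with domain $P^{\mathcal{A}}$ (defined only when this is a $\tau$-structure). -}

module Defs where

open import Level using (Level; 0ℓ; _⊔_) renaming (suc to lsuc)
open import Data.Bool using (if_then_else_)
open import Data.Fin using (Fin; toℕ)
open import Data.List using (List; []; _∷_; _++_; _∷ʳ_; map; concatMap)
open import Data.List.Membership.Propositional using (_∈_)
open import Data.List.Relation.Unary.Any using (Any)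
open import Data.Nat using (ℕ; zero; suc; _+_; _<_)
open import Data.Nat.Properties using (_≟_)
open import Data.Product using (Σ; Σ-syntax; ∃; ∃-syntax; _×_; _,_; proj₁; proj₂)
open import Data.Sum using (_⊎_)
open import Data.Vec as Vec using (Vec; []; _∷_; lookup)
open import Data.Vec.Relation.Binary.Pointwise.Inductive as Pointwise using (Pointwise)
open import Data.Vec.Relation.Unary.All using (All; universal)
open import Data.Vec.Relation.Unary.All.Properties using (map⁺)
open import Function using (id; _∘_)
open import Function.Bundles using (_⇔_; _↔_; Equivalence; Inverse)
open import Induction.WellFounded using (WellFounded; Acc; acc)
open import Relation.Binary.Bundles using (Setoid)
import Relation.Binary.Construct.On as On
open import Relation.Binary.PropositionalEquality using (_≡_; _≢_; refl)
open import Relation.Nullary using (¬_; Dec; does)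
open import Relation.Unary using (Pred; _≐_)

-- Symbols are indexed by arity; constants are the 0-ary function symbols.
record Language : Set₁ where
  field
    Fun : ℕ → Set
    Rel : ℕ → Set

open Language

record IsFinite (τ : Language) : Set where
  field
    {#fun} {#rel} : ℕ
    fun-enum : ∃ (Fun τ) ↔ Fin #fun
    rel-enum : ∃ (Rel τ) ↔ Fin #rel

  funIndex : ∀ {n} → Fun τ n → ℕ
  funIndex f = toℕ (Inverse.to fun-enum (_ , f))

  relIndex : ∀ {n} → Rel τ n → ℕ
  relIndex R = toℕ (Inverse.to rel-enum (_ , R))

record _⊆ᴸ_ (τ τ* : Language) : Set where
  field
    fun     : ∀ {n} → Fun τ n → Fun τ* n
    rel     : ∀ {n} → Rel τ n → Rel τ* n
    fun-inj : ∀ {n} {f g : Fun τ n} → fun f ≡ fun g → f ≡ g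
    rel-inj : ∀ {n} {R S : Rel τ n} → rel R ≡ rel S → R ≡ S

-- The domain is a setoid, whose equality interprets the equality symbol.
-- Domains are nonempty.
record Structure (τ : Language) : Set₁ where
  field
    setoid : Setoid 0ℓ 0ℓ
  open Setoid setoid public using (Carrier; _≈_)
  field
    fun      : ∀ {n} → Fun τ n → Vec Carrier n → Carrier
    fun-cong : ∀ {n} (f : Fun τ n) {xs ys} → Pointwise _≈_ xs ys → fun f xs ≈ fun f ys
    rel      : ∀ {n} → Rel τ n → Vec Carrier n → Set
    rel-resp : ∀ {n} (R : Rel τ n) {xs ys} → Pointwise _≈_ xs ys → rel R xs → rel R ys
    point    : Carrier

reduct : ∀ {τ τ*} → τ ⊆ᴸ τ* → Structure τ* → Structure τ
reduct ι A = record
  { setoid   = A.setoid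
  ; fun      = A.fun ∘ ι.fun
  ; fun-cong = A.fun-cong ∘ ι.fun
  ; rel      = A.rel ∘ ι.rel
  ; rel-resp = A.rel-resp ∘ ι.rel
  ; point    = A.point
  }
  where
  module A = Structure A
  module ι = _⊆ᴸ_ ι

-- 𝒜_P is defined exactly when P is such a domain.
record IsDomain {τ} (A : Structure τ) (P : Pred (Structure.Carrier A) 0ℓ) : Set where
  open Structure A
  field
    nonempty : ∃ P
    closed   : ∀ {n} (f : Fun τ n) {xs} → All P xs → P (fun f xs)

substructure : ∀ {τ} (A : Structure τ) (P : Pred (Structure.Carrier A) 0ℓ) →
               IsDomain A P → Structure τ
substructure A P d = record
  { setoid   = On.setoid A.setoid (proj₁ {B = P})
  ; fun      = λ f xs → A.fun f (Vec.map proj₁ xs) , d.closed f (map⁺ (universal proj₂ xs))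
  ; fun-cong = λ f → A.fun-cong f ∘ Pointwise.map⁺ id
  ; rel      = λ R xs → A.rel R (Vec.map proj₁ xs)
  ; rel-resp = λ R → A.rel-resp R ∘ Pointwise.map⁺ id
  ; point    = d.nonempty
  }
  where
  module A = Structure A
  module d = IsDomain d

record _≅_ {τ} (A B : Structure τ) : Set where
  private
    module A = Structure A
    module B = Structure B
  field
    inverse : Inverse A.setoid B.setoid
  open Inverse inverse public using (to; from)
  field
    fun-homo : ∀ {n} (f : Fun τ n) xs → to (A.fun f xs) B.≈ B.fun f (Vec.map to xs)
    rel-iso  : ∀ {n} (R : Rel τ n) xs → A.rel R xs ⇔ B.rel R (Vec.map to xs)

data Term (τ : Language) (V : Set) : Set where
  var : V → Term τ V
  app : ∀ {n} → Fun τ n → Vec (Term τ V) n → Term τ V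

data Atom (τ : Language) (V : Set) : Set where
  eq  : Term τ V → Term τ V → Atom τ V
  rel : ∀ {n} → Rel τ n → Vec (Term τ V) n → Atom τ V

module _ {τ} (A : Structure τ) {V : Set} (s : V → Structure.Carrier A) where
  private module A = Structure A

  mutual
    ⟦_⟧ᵗ : Term τ V → A.Carrier
    ⟦ var x ⟧ᵗ    = s x
    ⟦ app f ts ⟧ᵗ = A.fun f ⟦ ts ⟧ᵗˢ

    ⟦_⟧ᵗˢ : ∀ {n} → Vec (Term τ V) n → Vec A.Carrier n
    ⟦ [] ⟧ᵗˢ     = []
    ⟦ t ∷ ts ⟧ᵗˢ = ⟦ t ⟧ᵗ ∷ ⟦ ts ⟧ᵗˢ

  ⟦_⟧ᵃ : Atom τ V → Set
  ⟦ eq t u ⟧ᵃ   = ⟦ t ⟧ᵗ A.≈ ⟦ u ⟧ᵗ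
  ⟦ rel R ts ⟧ᵃ = A.rel R ⟦ ts ⟧ᵗˢ

data FOFormula (τ : Language) (n : ℕ) : Set where
  atom          : Atom τ (Fin n) → FOFormula τ n
  not           : FOFormula τ n → FOFormula τ n
  and or implies : FOFormula τ n → FOFormula τ n → FOFormula τ n
  exists forAll : FOFormula τ (suc n) → FOFormula τ n

FOSentence : Language → Set
FOSentence τ = FOFormula τ 0

-- Here and in Sat below, satisfaction is Tarski's definition with the connectives
-- of the metatheory; excluded middle is not assumed.
FOSat : ∀ {τ} (A : Structure τ) {n} → Vec (Structure.Carrier A) n → FOFormula τ n → Set
FOSat A ρ (atom α)      = ⟦_⟧ᵃ A (lookup ρ) α
FOSat A ρ (not φ)       = ¬ FOSat A ρ φ
FOSat A ρ (and φ ψ)     = FOSat A ρ φ × FOSat A ρ ψ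
FOSat A ρ (or φ ψ)      = FOSat A ρ φ ⊎ FOSat A ρ ψ
FOSat A ρ (implies φ ψ) = FOSat A ρ φ → FOSat A ρ ψ
FOSat A ρ (exists φ)    = ∃[ a ] FOSat A (a ∷ ρ) φ
FOSat A ρ (forAll φ)    = ∀ a → FOSat A (a ∷ ρ) φ

_⊨ᶠᵒ_ : ∀ {τ} → Structure τ → FOSentence τ → Set
A ⊨ᶠᵒ φ = FOSat A [] φ

data Literal (τ : Language) : Set where
  pos neg : Atom τ ℕ → Literal τ

-- A list of literals stands for its disjunction; the empty one is false.
Clause : Language → Set
Clause τ = List (Literal τ)

-- ⋀⋀ and ⋁⋁ range over a subset I of ℕ, as the children of a node do.
data Formula (τ : Language) : Set₁ where
  clause : Clause τ → Formula τ
  ex all : ℕ → Formula τ → Formula τ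
  ⋀⋀ ⋁⋁  : (I : Pred ℕ 0ℓ) → (∀ i → I i → Formula τ) → Formula τ

mutual
  termVars : ∀ {τ} → Term τ ℕ → List ℕ
  termVars (var i)    = i ∷ []
  termVars (app _ ts) = termsVars ts

  termsVars : ∀ {τ n} → Vec (Term τ ℕ) n → List ℕ
  termsVars []       = []
  termsVars (t ∷ ts) = termVars t ++ termsVars ts

atomVars : ∀ {τ} → Atom τ ℕ → List ℕ
atomVars (eq t u)   = termVars t ++ termVars u
atomVars (rel _ ts) = termsVars ts

literalVars : ∀ {τ} → Literal τ → List ℕ
literalVars (pos α) = atomVars α
literalVars (neg α) = atomVars α

clauseVars : ∀ {τ} → Clause τ → List ℕ
clauseVars = concatMap literalVars

_[_≔_] : ∀ {A : Set} → (ℕ → A) → ℕ → A → ℕ → A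
(s [ i ≔ a ]) j = if does (j ≟ i) then a else s j

module _ {τ} (A : Structure τ) where
  private module A = Structure A

  LiteralSat : (ℕ → A.Carrier) → Literal τ → Set
  LiteralSat s (pos α) = ⟦_⟧ᵃ A s α
  LiteralSat s (neg α) = ¬ ⟦_⟧ᵃ A s α

  Sat : (ℕ → A.Carrier) → Formula τ → Set
  Sat s (clause ψ) = Any (LiteralSat s) ψ
  Sat s (ex i φ)   = ∃[ a ] Sat (s [ i ≔ a ]) φ
  Sat s (all i φ)  = ∀ a → Sat (s [ i ≔ a ]) φ
  Sat s (⋀⋀ I φ)   = ∀ i (p : I i) → Sat s (φ i p)
  Sat s (⋁⋁ I φ)   = ∃[ i ] Σ[ p ∈ I i ] Sat s (φ i p)

_⊨_ : ∀ {τ} → Structure τ → Formula τ → Set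
A ⊨ φ = ∀ s → Sat A s φ

triangle : ℕ → ℕ
triangle zero    = 0
triangle (suc n) = suc n + triangle n

-- Cantor's bijection ℕ × ℕ → ℕ.
pair : ℕ → ℕ → ℕ
pair m n = triangle (m + n) + n

⟨_⟩ : List ℕ → ℕ
⟨ [] ⟩     = 0
⟨ i ∷ is ⟩ = suc (pair i ⟨ is ⟩)

data Label (τ : Language) : Set where
  clause : Clause τ → Label τ
  ∃x ∀x  : ℕ → Label τ
  ⋀⋀ ⋁⋁  : Label τ

module Coding {τ} (fin : IsFinite τ) where
  open IsFinite fin

  mutual
    codeTerm : Term τ ℕ → ℕ
    codeTerm (var i)    = pair 0 i
    codeTerm (app f ts) = pair (suc (funIndex f)) ⟨ codeTerms ts ⟩

    codeTerms : ∀ {n} → Vec (Term τ ℕ) n → List ℕ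
    codeTerms []       = []
    codeTerms (t ∷ ts) = codeTerm t ∷ codeTerms ts

  codeAtom : Atom τ ℕ → ℕ
  codeAtom (eq t u)   = pair 0 (pair (codeTerm t) (codeTerm u))
  codeAtom (rel R ts) = pair (suc (relIndex R)) ⟨ codeTerms ts ⟩

  codeLiteral : Literal τ → ℕ
  codeLiteral (pos α) = pair 0 (codeAtom α)
  codeLiteral (neg α) = pair 1 (codeAtom α)

  ⌜_⌝ : Label τ → ℕ
  ⌜ clause ψ ⌝ = pair 0 ⟨ map codeLiteral ψ ⟩
  ⌜ ∃x i ⌝     = pair 1 i
  ⌜ ∀x i ⌝     = pair 2 i
  ⌜ ⋀⋀ ⌝       = pair 3 0
  ⌜ ⋁⋁ ⌝       = pair 4 0

module _ {τ} (fin : IsFinite τ) where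
  open Coding fin

  -- A finite set v σ of variable indices is given by a list of its elements, so
  -- two lists denote the same set when they have the same members.
  data Node (T : Pred (List ℕ) 0ℓ) (l : List ℕ → ℕ) (v : List ℕ → List ℕ) (σ : List ℕ) : Set where
    leaf : ∀ ψ → (∀ i → ¬ T (σ ∷ʳ i)) →
           l σ ≡ ⌜ clause ψ ⌝ → (_∈ v σ) ≐ (_∈ clauseVars ψ) → Node T l v σ
    ex   : ∀ i → (∀ j → T (σ ∷ʳ j) ⇔ j ≡ 0) →
           l σ ≡ ⌜ ∃x i ⌝ → (_∈ v σ) ≐ (λ j → j ∈ v (σ ∷ʳ 0) × j ≢ i) → Node T l v σ
    all  : ∀ i → (∀ j → T (σ ∷ʳ j) ⇔ j ≡ 0) →
           l σ ≡ ⌜ ∀x i ⌝ → (_∈ v σ) ≐ (λ j → j ∈ v (σ ∷ʳ 0) × j ≢ i) → Node T l v σ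
    conj : l σ ≡ ⌜ ⋀⋀ ⌝ →
           (_∈ v σ) ≐ (λ j → ∃[ i ] T (σ ∷ʳ i) × j ∈ v (σ ∷ʳ i)) → Node T l v σ
    disj : l σ ≡ ⌜ ⋁⋁ ⌝ →
           (_∈ v σ) ≐ (λ j → ∃[ i ] T (σ ∷ʳ i) × j ∈ v (σ ∷ʳ i)) → Node T l v σ

  -- The values of l and v outside T are irrelevant.
  record LabeledTree : Set₁ where
    field
      T             : Pred (List ℕ) 0ℓ
      root          : T []
      prefix-closed : ∀ {σ i} → T (σ ∷ʳ i) → T σ
      l             : List ℕ → ℕ
      v             : List ℕ → List ℕ
      node          : ∀ {σ} → T σ → Node T l v σ

    ChildOf : List ℕ → List ℕ → Set
    ChildOf ρ σ = ∃[ i ] ρ ≡ σ ∷ʳ i × T ρ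

  record FormulaCode : Set₁ where
    field
      tree        : LabeledTree
    open LabeledTree tree public
    field
      wellFounded : WellFounded ChildOf

    decodeAt : ∀ {σ} → T σ → Acc ChildOf σ → Formula τ
    decodeAt {σ} p (acc rs) with node p
    ... | leaf ψ _ _ _     = clause ψ
    ... | ex i child _ _   = ex i (decodeAt p₀ (rs (0 , refl , p₀)))
      where p₀ = Equivalence.from (child 0) refl
    ... | all i child _ _  = all i (decodeAt p₀ (rs (0 , refl , p₀)))
      where p₀ = Equivalence.from (child 0) refl
    ... | conj _ _         = ⋀⋀ (λ i → T (σ ∷ʳ i)) (λ i q → decodeAt q (rs (i , refl , q)))
    ... | disj _ _         = ⋁⋁ (λ i → T (σ ∷ʳ i)) (λ i q → decodeAt q (rs (i , refl , q)))

    decode : Formula τ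
    decode = decodeAt root (wellFounded [])

    IsSentenceCode : Set
    IsSentenceCode = v [] ≡ []

    No⋁⋁ : Set
    No⋁⋁ = ∀ {σ} → T σ → l σ ≢ ⌜ ⋁⋁ ⌝

data Rec : ℕ → Set where
  zero : Rec 0
  succ : Rec 1
  proj : ∀ {n} → Fin n → Rec n
  comp : ∀ {m n} → Rec m → Vec (Rec n) m → Rec n
  prim : ∀ {n} → Rec n → Rec (suc (suc n)) → Rec (suc n)
  mu   : ∀ {n} → Rec (suc n) → Rec n

mutual
  data _[_]⇓_ : ∀ {n} → Rec n → Vec ℕ n → ℕ → Set where
    zero     : zero [ [] ]⇓ 0
    succ     : ∀ {x} → succ [ x ∷ [] ]⇓ suc x
    proj     : ∀ {n} {i : Fin n} {xs} → proj i [ xs ]⇓ lookup xs i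
    comp     : ∀ {m n} {f : Rec m} {gs : Vec (Rec n) m} {xs ys z} →
               gs [ xs ]⇓* ys → f [ ys ]⇓ z → comp f gs [ xs ]⇓ z
    prim-zero : ∀ {n} {f : Rec n} {g xs y} →
               f [ xs ]⇓ y → prim f g [ 0 ∷ xs ]⇓ y
    prim-suc : ∀ {n} {f : Rec n} {g xs k y z} →
               prim f g [ k ∷ xs ]⇓ y → g [ k ∷ y ∷ xs ]⇓ z → prim f g [ suc k ∷ xs ]⇓ z
    mu       : ∀ {n} {f : Rec (suc n)} {xs y} →
               f [ y ∷ xs ]⇓ 0 → (∀ z → z < y → ∃[ k ] f [ z ∷ xs ]⇓ suc k) → mu f [ xs ]⇓ y

  data _[_]⇓*_ {n} : ∀ {m} → Vec (Rec n) m → Vec ℕ n → Vec ℕ m → Set where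
    []  : ∀ {xs} → [] [ xs ]⇓* []
    _∷_ : ∀ {m} {g : Rec n} {gs : Vec (Rec n) m} {xs y ys} →
          g [ xs ]⇓ y → gs [ xs ]⇓* ys → (g ∷ gs) [ xs ]⇓* (y ∷ ys)

ComputableSet : Pred (List ℕ) 0ℓ → Set
ComputableSet T =
  Σ[ e ∈ Rec 1 ] ∀ σ → Σ[ d ∈ Dec (T σ) ] e [ ⟨ σ ⟩ ∷ [] ]⇓ (if does d then 1 else 0)

-- e computes a partial function that agrees with f on T; its behaviour outside T
-- is unconstrained.
ComputableOn : Pred (List ℕ) 0ℓ → (List ℕ → ℕ) → Set
ComputableOn T f = Σ[ e ∈ Rec 1 ] ∀ {σ} → T σ → e [ ⟨ σ ⟩ ∷ [] ]⇓ f σ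

record IsComputable {τ} {fin : IsFinite τ} (C : FormulaCode fin) : Set where
  open FormulaCode C
  field
    T-computable : ComputableSet T
    l-computable : ComputableOn T l
    v-computable : ComputableOn T (⟨_⟩ ∘ v)

record AxiomatizedByComputable⋀⋀ {τ} (fin : IsFinite τ) {k} (K : Pred (Structure τ) k) :
       Set (lsuc 0ℓ ⊔ k) where
  field
    code       : FormulaCode fin
    computable : IsComputable code
  open FormulaCode code
  field
    sentence   : IsSentenceCode
    no⋁⋁       : No⋁⋁
    axiomatizes : ∀ B → K B ⇔ (B ⊨ decode)

-- K = {𝒜_P : 𝒜 ⊨ φ and 𝒜_P is defined}, with structures identified up to
-- isomorphism.
record IsPC′ {τ} {k} (K : Pred (Structure τ) k) : Set (lsuc 0ℓ ⊔ k) where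
  field
    τ*  : Language
    τ⊆  : τ ⊆ᴸ τ*
    P   : Rel τ* 1
    P∉τ : ∀ R → _⊆ᴸ_.rel τ⊆ R ≢ P
    φ   : FOSentence τ*

  Pᴬ : (A : Structure τ*) → Pred (Structure.Carrier A) 0ℓ
  Pᴬ A a = Structure.rel A P (a ∷ [])

  field
    characterizes : ∀ B → K B ⇔
      (∃[ A ] A ⊨ᶠᵒ φ ×
        Σ[ d ∈ IsDomain (reduct τ⊆ A) (Pᴬ A) ] B ≅ substructure (reduct τ⊆ A) (Pᴬ A) d)

{-# OPTIONS --safe #-}

module Submission where

-- The structures for τ⁺ contain, besides the domain P of a τ-structure, numbers and
-- sequences of elements of P serving as variable assignments.  Horn axioms force every
-- terminating computation to be recorded correctly on the standard numbers, and further
-- axioms say that a predicate Nodeᵀ(σ, w) ("the formula at node σ holds under w") is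
-- preserved downwards from each node to its children.  As there are no infinite
-- disjunctions, induction on the well-founded tree never leaves the standard numbers,
-- so Nodeᵀ at the root implies truth, even if A contains nonstandard nodes.
-- Conversely a model B of the sentence expands to ℕ × (ℕ → B), where Nodeᵀ is truth.
-- The axioms are needed in one direction only, which makes the argument constructive.

open import Defs
open import Data.Bool using (true; false; if_then_else_)
open import Data.Empty using (⊥-elim)
open import Data.Fin using (Fin; zero; suc)
open import Data.Fin.Properties using (toℕ-injective)
open import Data.List using (List; []; _∷_; _∷ʳ_; map)
open import Data.List.Membership.Propositional using (_∈_)
open import Data.List.Membership.Propositional.Properties using (∈-++⁺ˡ; ∈-++⁺ʳ)
open import Data.List.Relation.Unary.Any using (Any; here; there)
open import Data.Nat using (ℕ; zero; suc; _+_; _<_; _≤_)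
open import Data.Nat.Properties
  using (+-comm; +-suc; +-identityʳ; suc-injective; m<1+n⇒m<n∨m≡n; <-cmp; ≤-refl; <⇒≤; _≟_)
open import Data.Product using (Σ-syntax; ∃; ∃-syntax; _×_; _,_; proj₁; proj₂)
open import Data.Sum using (_⊎_; inj₁; inj₂)
open import Data.Vec as Vec using (Vec; []; _∷_; lookup; toList)
open import Data.Vec.Relation.Binary.Pointwise.Inductive as Pointwise using (Pointwise; []; _∷_)
open import Function using (_∘_; const)
open import Function.Bundles using (Equivalence; Inverse; mk⇔)
open import Induction.WellFounded using (Acc; acc)
open import Level using (0ℓ)
open import Relation.Binary.Bundles using (Setoid)
open import Relation.Binary.Definitions using (tri<; tri≈; tri>)
open import Relation.Binary.PropositionalEquality
  using (_≡_; _≢_; refl; sym; trans; cong; cong₂; subst)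
open import Relation.Nullary using (¬_; Dec; yes; no; does; contradiction)
open import Relation.Unary using (Pred)

open Language
open IsFinite using (fun-enum; rel-enum; funIndex; relIndex)

-- Cantor's enumeration of pairs and its injectivity.

pair-suc : ∀ m n → pair m (suc n) ≡ suc (pair (suc m) n)
pair-suc m n rewrite +-suc m n = +-suc (triangle (suc (m + n))) n

-- Together with `pair-suc` this describes the walk along the antidiagonals: one step back leads
-- from `(m, suc n)` to `(suc m, n)`, and from `(suc n, 0)` to `(0, n)`.
pair-zero : ∀ n → pair (suc n) 0 ≡ suc (pair 0 n)
pair-zero n rewrite +-identityʳ n | +-identityʳ (n + triangle n) =
  cong suc (+-comm n (triangle n))

private
  -- pair enumerates ℕ × ℕ, so injectivity follows by descending along the enumeration.
  pair-injective-at : ∀ k m n m′ n′ → pair m n ≡ k → pair m′ n′ ≡ k → m ≡ m′ × n ≡ n′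
  pair-injective-at k zero zero zero zero _ _ = refl , refl
  pair-injective-at k m (suc n) zero zero p refl with () ← trans (sym (pair-suc m n)) p
  pair-injective-at k (suc m) zero zero zero p refl with () ← trans (sym (pair-zero m)) p
  pair-injective-at k zero zero m (suc n) refl p with () ← trans (sym (pair-suc m n)) p
  pair-injective-at k zero zero (suc m) zero refl p with () ← trans (sym (pair-zero m)) p
  pair-injective-at zero m (suc n) _ _ p _ with () ← trans (sym (pair-suc m n)) p
  pair-injective-at zero (suc m) zero _ _ p _ with () ← trans (sym (pair-zero m)) p
  pair-injective-at (suc k) m (suc n) m′ (suc n′) p q
    with refl , refl ← pair-injective-at k (suc m) n (suc m′) n′
                         (suc-injective (trans (sym (pair-suc m n)) p))
                         (suc-injective (trans (sym (pair-suc m′ n′)) q)) = refl , refl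
  pair-injective-at (suc k) m (suc n) (suc m′) zero p q
    with () ← proj₁ (pair-injective-at k (suc m) n 0 m′
                         (suc-injective (trans (sym (pair-suc m n)) p))
                         (suc-injective (trans (sym (pair-zero m′)) q)))
  pair-injective-at (suc k) (suc m) zero m′ (suc n′) p q
    with () ← proj₁ (pair-injective-at k 0 m (suc m′) n′
                         (suc-injective (trans (sym (pair-zero m)) p))
                         (suc-injective (trans (sym (pair-suc m′ n′)) q)))
  pair-injective-at (suc k) (suc m) zero (suc m′) zero p q
    with refl ← proj₂ (pair-injective-at k 0 m 0 m′
                         (suc-injective (trans (sym (pair-zero m)) p))
                         (suc-injective (trans (sym (pair-zero m′)) q))) = refl , refl

pair-injective : ∀ {m n m′ n′} → pair m n ≡ pair m′ n′ → m ≡ m′ × n ≡ n′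
pair-injective p = pair-injective-at _ _ _ _ _ p refl

-- Runs of recursive functions and coded argument lists.

⟨_⟩ᵛ : ∀ {n} → Vec ℕ n → ℕ
⟨ xs ⟩ᵛ = ⟨ toList xs ⟩

mutual
  ⇓-functional : ∀ {n} {f : Rec n} {xs y z} → f [ xs ]⇓ y → f [ xs ]⇓ z → y ≡ z
  ⇓-functional zero zero = refl
  ⇓-functional succ succ = refl
  ⇓-functional proj proj = refl
  ⇓-functional (comp gs f) (comp gs′ f′) with refl ← ⇓*-functional gs gs′ = ⇓-functional f f′
  ⇓-functional (prim-zero f) (prim-zero f′) = ⇓-functional f f′
  ⇓-functional (prim-suc r g) (prim-suc r′ g′) with refl ← ⇓-functional r r′ = ⇓-functional g g′
  -- If the results differed, `f` would be 0 at the smaller one by one run and positive there by the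
  -- other.
  ⇓-functional {y = y} {z} (mu f b) (mu f′ b′) with <-cmp y z
  ... | tri≈ _ y≡z _ = y≡z
  ... | tri< y<z _ _ with () ← ⇓-functional f (proj₂ (b′ y y<z))
  ... | tri> _ _ z<y with () ← ⇓-functional f′ (proj₂ (b z z<y))

  ⇓*-functional : ∀ {n m} {gs : Vec (Rec n) m} {xs ys zs} →
                  gs [ xs ]⇓* ys → gs [ xs ]⇓* zs → ys ≡ zs
  ⇓*-functional []       []         = refl
  ⇓*-functional (g ∷ gs) (g′ ∷ gs′) = cong₂ _∷_ (⇓-functional g g′) (⇓*-functional gs gs′)

cons-injective : ∀ {m x n} y (ys : Vec ℕ n) → suc (pair m x) ≡ ⟨ y ∷ ys ⟩ᵛ → m ≡ y × x ≡ ⟨ ys ⟩ᵛ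
cons-injective {m} {x} y ys p = pair-injective {m} {x} {y} {⟨ ys ⟩ᵛ} (suc-injective p)

cons-code : ∀ {n x} {xs : Vec ℕ n} y → x ≡ ⟨ xs ⟩ᵛ → suc (pair y x) ≡ ⟨ y ∷ xs ⟩ᵛ
cons-code y = cong λ n → suc (pair y n)

proj-suc : ∀ {n} {i : Fin n} {x xs y} → proj i [ xs ]⇓ y → proj (suc i) [ x ∷ xs ]⇓ y
proj-suc proj = proj

-- Shaped for the expansion below, where `Eval` speaks of every vector with a given code: the first
-- premise is what `cons-injective` returns, and the run is available only once `x` is known to code
-- `xs`.
prim-base : ∀ {n} {f : Rec n} {g xs x y m} → 0 ≡ m × x ≡ ⟨ xs ⟩ᵛ →
            (x ≡ ⟨ xs ⟩ᵛ → f [ xs ]⇓ y) → prim f g [ m ∷ xs ]⇓ y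
prim-base (refl , p) f⇓ = prim-zero (f⇓ p)

prim-step : ∀ {n} {f : Rec n} {g xs x y z k m} → suc k ≡ m × x ≡ ⟨ xs ⟩ᵛ →
            (x ≡ ⟨ xs ⟩ᵛ → prim f g [ k ∷ xs ]⇓ y) →
            (x ≡ ⟨ xs ⟩ᵛ → g [ k ∷ y ∷ xs ]⇓ z) → prim f g [ m ∷ xs ]⇓ z
prim-step (refl , p) r⇓ g⇓ = prim-suc (r⇓ p) (g⇓ p)

positive-step : ∀ {n} {f : Rec (suc n)} xs {y} → (∀ z → z < y → ∃[ k ] f [ z ∷ xs ]⇓ suc k) →
                ∃[ k ] f [ y ∷ xs ]⇓ suc k → ∀ z → z < suc y → ∃[ k ] f [ z ∷ xs ]⇓ suc k
positive-step xs below at z z<1+y with m<1+n⇒m<n∨m≡n z<1+y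
... | inj₁ z<y  = below z z<y
... | inj₂ refl = at

-- The language `τ⁺` and its axioms.

module Vocabulary (τ : Language) where

  -- Two kinds of lists occur. Lists of numbers are numbers, built with `sucˢ` and `pairˢ` as in
  -- `⟨_⟩`; sequences of elements are built with `pushˢ` and read with `headˢ`, `tailˢ` and
  -- `valueˢ`.
  data Fun⁺ : ℕ → Set where
    old                   : ∀ {n} → Fun τ n → Fun⁺ n
    zeroˢ                 : Fun⁺ 0
    sucˢ headˢ tailˢ      : Fun⁺ 1
    pairˢ pushˢ valueˢ    : Fun⁺ 2
    updateˢ               : Fun⁺ 3

  -- Eval f, Evals gs: the value(s) at the argument list with a given code.
  -- PositiveBelow f (y, x): f(z, x) > 0 for all z < y, as needed for mu.
  -- TermValue (n, w, b), TermsValue (n, w, u): the term (list) coded by n takes the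
  -- value b (the initial entries of u) under the assignment w.
  data Rel⁺ : ℕ → Set where
    old                  : ∀ {n} → Rel τ n → Rel⁺ n
    Domain               : Rel⁺ 1
    Eval                 : ∀ {n} → Rec n → Rel⁺ 2
    Evals                : ∀ {m n} → Vec (Rec n) m → Rel⁺ 2
    PositiveBelow        : ∀ {n} → Rec (suc n) → Rel⁺ 2
    TermValue TermsValue : Rel⁺ 3
    Literalᵀ Clauseᵀ     : Rel⁺ 2
    Snoc                 : Rel⁺ 3
    Nodeᵀ                : Rel⁺ 2

  τ⁺ : Language
  τ⁺ = record { Fun = Fun⁺ ; Rel = Rel⁺ }

  τ⊆τ⁺ : τ ⊆ᴸ τ⁺
  τ⊆τ⁺ = record
    { fun = old ; rel = old
    ; fun-inj = λ { refl → refl } ; rel-inj = λ { refl → refl } }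

  Tm : ℕ → Set
  Tm n = Term τ⁺ (Fin n)

  0ᵗ : ∀ {n} → Tm n
  0ᵗ = app zeroˢ []

  sucᵗ headᵗ tailᵗ : ∀ {n} → Tm n → Tm n
  sucᵗ t  = app sucˢ (t ∷ [])
  headᵗ t = app headˢ (t ∷ [])
  tailᵗ t = app tailˢ (t ∷ [])

  pairᵗ pushᵗ valueᵗ consᵗ : ∀ {n} → Tm n → Tm n → Tm n
  pairᵗ t u  = app pairˢ (t ∷ u ∷ [])
  pushᵗ t u  = app pushˢ (t ∷ u ∷ [])
  valueᵗ t u = app valueˢ (t ∷ u ∷ [])
  consᵗ t u  = sucᵗ (pairᵗ t u)

  updateᵗ : ∀ {n} → Tm n → Tm n → Tm n → Tm n
  updateᵗ t u r = app updateˢ (t ∷ u ∷ r ∷ [])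

  numeralᵗ : ∀ {n} → ℕ → Tm n
  numeralᵗ zero    = 0ᵗ
  numeralᵗ (suc k) = sucᵗ (numeralᵗ k)

  entriesᵗ : ∀ {n} k → Tm n → Vec (Tm n) k
  entriesᵗ zero    u = []
  entriesᵗ (suc k) u = headᵗ u ∷ entriesᵗ k (tailᵗ u)

  x₀ : ∀ {n} → Tm (suc n)
  x₀ = var zero
  x₁ : ∀ {n} → Tm (suc (suc n))
  x₁ = var (suc zero)
  x₂ : ∀ {n} → Tm (suc (suc (suc n)))
  x₂ = var (suc (suc zero))
  x₃ : ∀ {n} → Tm (suc (suc (suc (suc n))))
  x₃ = var (suc (suc (suc zero)))
  x₄ : ∀ {n} → Tm (suc (suc (suc (suc (suc n)))))
  x₄ = var (suc (suc (suc (suc zero))))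

  infixr 3 _⇒_
  infixr 2 _&_
  infix  4 _≈ᶠ_

  _⇒_ _&_ : ∀ {n} → FOFormula τ⁺ n → FOFormula τ⁺ n → FOFormula τ⁺ n
  _⇒_ = implies
  _&_ = and

  _≈ᶠ_ : ∀ {n} → Tm n → Tm n → FOFormula τ⁺ n
  t ≈ᶠ u = atom (eq t u)

  _⟨_⟩¹ : ∀ {n} → Rel⁺ 1 → Tm n → FOFormula τ⁺ n
  R ⟨ t ⟩¹ = atom (rel R (t ∷ []))

  _⟨_,_⟩² : ∀ {n} → Rel⁺ 2 → Tm n → Tm n → FOFormula τ⁺ n
  R ⟨ t , u ⟩² = atom (rel R (t ∷ u ∷ []))

  _⟨_,_,_⟩³ : ∀ {n} → Rel⁺ 3 → Tm n → Tm n → Tm n → FOFormula τ⁺ n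
  R ⟨ t , u , r ⟩³ = atom (rel R (t ∷ u ∷ r ∷ []))

  ∀¹ : ∀ {n} → FOFormula τ⁺ (1 + n) → FOFormula τ⁺ n
  ∀¹ = forAll
  ∀² : ∀ {n} → FOFormula τ⁺ (2 + n) → FOFormula τ⁺ n
  ∀² φ = forAll (∀¹ φ)
  ∀³ : ∀ {n} → FOFormula τ⁺ (3 + n) → FOFormula τ⁺ n
  ∀³ φ = forAll (∀² φ)
  ∀⁴ : ∀ {n} → FOFormula τ⁺ (4 + n) → FOFormula τ⁺ n
  ∀⁴ φ = forAll (∀³ φ)
  ∀⁵ : ∀ {n} → FOFormula τ⁺ (5 + n) → FOFormula τ⁺ n
  ∀⁵ φ = forAll (∀⁴ φ)

  -- There is no formula constant for truth, so a valid sentence stands for the empty conjunction.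
  ⋀ : ∀ {n} → (Fin n → FOSentence τ⁺) → FOSentence τ⁺
  ⋀ {zero}  φ = ∀¹ (x₀ ≈ᶠ x₀)
  ⋀ {suc n} φ = φ zero & ⋀ (φ ∘ suc)

  ⋀-intro : ∀ {A n} {φ : Fin n → FOSentence τ⁺} → (∀ i → A ⊨ᶠᵒ φ i) → A ⊨ᶠᵒ ⋀ φ
  ⋀-intro {A} {zero}  p = λ _ → Setoid.refl (Structure.setoid A)
  ⋀-intro {n = suc n} p = p zero , ⋀-intro (p ∘ suc)

  ⋀-elim : ∀ {A n} {φ : Fin n → FOSentence τ⁺} → A ⊨ᶠᵒ ⋀ φ → ∀ i → A ⊨ᶠᵒ φ i
  ⋀-elim (p , _) zero    = p
  ⋀-elim (_ , p) (suc i) = ⋀-elim p i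

  listAxioms : FOSentence τ⁺
  listAxioms =
    ∀¹ (Domain ⟨ headᵗ x₀ ⟩¹) &
    -- Conditional on `Domain` because in the expansion pushing an object keeps just its entry 0,
    -- which recovers the object only if it lies in `Domain`.
    ∀² (Domain ⟨ x₀ ⟩¹ ⇒ headᵗ (pushᵗ x₀ x₁) ≈ᶠ x₀) &
    ∀² (tailᵗ (pushᵗ x₀ x₁) ≈ᶠ x₁) &
    ∀¹ (valueᵗ x₀ 0ᵗ ≈ᶠ headᵗ x₀) &
    ∀² (valueᵗ x₀ (sucᵗ x₁) ≈ᶠ valueᵗ (tailᵗ x₀) x₁) &
    ∀² (updateᵗ x₀ 0ᵗ x₁ ≈ᶠ pushᵗ x₁ (tailᵗ x₀)) &
    ∀³ (updateᵗ x₀ (sucᵗ x₁) x₂ ≈ᶠ pushᵗ (headᵗ x₀) (updateᵗ (tailᵗ x₀) x₁ x₂))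

  -- The recurrences `pair-suc` and `pair-zero`; they determine `pairˢ` on the numerals.
  pairAxioms : FOSentence τ⁺
  pairAxioms =
    pairᵗ 0ᵗ 0ᵗ ≈ᶠ 0ᵗ &
    ∀² (pairᵗ x₁ (sucᵗ x₀) ≈ᶠ sucᵗ (pairᵗ (sucᵗ x₁) x₀)) &
    ∀¹ (pairᵗ (sucᵗ x₀) 0ᵗ ≈ᶠ sucᵗ (pairᵗ 0ᵗ x₀))

  projAxioms : ∀ {n} → Fin n → FOSentence τ⁺
  projAxioms {suc n} zero = ∀² (Eval (proj {suc n} zero) ⟨ consᵗ x₁ x₀ , x₁ ⟩²)
  projAxioms (suc i) =
    ∀³ (Eval (proj i) ⟨ x₁ , x₂ ⟩² ⇒ Eval (proj (suc i)) ⟨ consᵗ x₀ x₁ , x₂ ⟩²) &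
    projAxioms i

  mutual
    -- Each rule of `_[_]⇓_` becomes a closure axiom. The axioms of all subprograms are included, so
    -- one sentence suffices to simulate `f`.
    recAxioms : ∀ {n} → Rec n → FOSentence τ⁺
    recAxioms zero        = Eval zero ⟨ 0ᵗ , 0ᵗ ⟩²
    recAxioms succ        = ∀¹ (Eval succ ⟨ consᵗ x₀ 0ᵗ , sucᵗ x₀ ⟩²)
    recAxioms (proj i)    = projAxioms i
    recAxioms (comp f gs) =
      ∀³ (Evals gs ⟨ x₀ , x₁ ⟩² ⇒ Eval f ⟨ x₁ , x₂ ⟩² ⇒ Eval (comp f gs) ⟨ x₀ , x₂ ⟩²) &
      recAxioms f & recsAxioms gs
    recAxioms (prim f g)  =
      ∀² (Eval f ⟨ x₀ , x₁ ⟩² ⇒ Eval (prim f g) ⟨ consᵗ 0ᵗ x₀ , x₁ ⟩²) &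
      ∀⁴ (Eval (prim f g) ⟨ consᵗ x₁ x₀ , x₂ ⟩² ⇒
          Eval g ⟨ consᵗ x₁ (consᵗ x₂ x₀) , x₃ ⟩² ⇒
          Eval (prim f g) ⟨ consᵗ (sucᵗ x₁) x₀ , x₃ ⟩²) &
      recAxioms f & recAxioms g
    recAxioms (mu f)      =
      -- The bounded quantifier in the rule for `mu` is replaced by an induction on the bound, which
      -- keeps the axioms Horn.
      ∀¹ (PositiveBelow f ⟨ 0ᵗ , x₀ ⟩²) &
      ∀³ (PositiveBelow f ⟨ x₁ , x₀ ⟩² ⇒ Eval f ⟨ consᵗ x₁ x₀ , sucᵗ x₂ ⟩² ⇒
          PositiveBelow f ⟨ sucᵗ x₁ , x₀ ⟩²) &
      ∀² (PositiveBelow f ⟨ x₁ , x₀ ⟩² ⇒ Eval f ⟨ consᵗ x₁ x₀ , 0ᵗ ⟩² ⇒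
          Eval (mu f) ⟨ x₀ , x₁ ⟩²) &
      recAxioms f

    recsAxioms : ∀ {m n} → Vec (Rec n) m → FOSentence τ⁺
    recsAxioms {n = n} [] = ∀¹ (Evals {n = n} [] ⟨ x₀ , 0ᵗ ⟩²)
    recsAxioms (g ∷ gs) =
      ∀³ (Eval g ⟨ x₀ , x₁ ⟩² ⇒ Evals gs ⟨ x₀ , x₂ ⟩² ⇒
          Evals (g ∷ gs) ⟨ x₀ , consᵗ x₁ x₂ ⟩²) &
      recAxioms g & recsAxioms gs

  snocAxioms : FOSentence τ⁺
  snocAxioms =
    ∀¹ (Snoc ⟨ 0ᵗ , x₀ , consᵗ x₀ 0ᵗ ⟩³) &
    ∀⁴ (Snoc ⟨ x₀ , x₁ , x₂ ⟩³ ⇒ Snoc ⟨ consᵗ x₃ x₀ , x₁ , consᵗ x₃ x₂ ⟩³)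

  termAxioms : FOSentence τ⁺
  termAxioms =
    ∀² (TermValue ⟨ pairᵗ 0ᵗ x₁ , x₀ , valueᵗ x₀ x₁ ⟩³) &
    -- Every sequence serves the empty list, since only as many entries count as there are terms.
    ∀² (TermsValue ⟨ 0ᵗ , x₀ , x₁ ⟩³) &
    ∀⁵ (TermValue ⟨ x₁ , x₀ , x₂ ⟩³ ⇒ TermsValue ⟨ x₃ , x₀ , x₄ ⟩³ ⇒
        TermsValue ⟨ consᵗ x₁ x₃ , x₀ , pushᵗ x₂ x₄ ⟩³)

  eqAxioms : FOSentence τ⁺
  eqAxioms =
    -- The `Domain` premises matter in the expansion: there `TermValue` fixes entry 0 alone, so two
    -- values of the same term can be different objects outside `Domain`.
    ∀⁵ (Literalᵀ ⟨ pairᵗ (numeralᵗ 0) (pairᵗ 0ᵗ (pairᵗ x₁ x₂)) , x₀ ⟩² ⇒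
        TermValue ⟨ x₁ , x₀ , x₃ ⟩³ ⇒ TermValue ⟨ x₂ , x₀ , x₄ ⟩³ ⇒
        Domain ⟨ x₃ ⟩¹ ⇒ Domain ⟨ x₄ ⟩¹ ⇒ x₃ ≈ᶠ x₄) &
    ∀⁵ (Literalᵀ ⟨ pairᵗ (numeralᵗ 1) (pairᵗ 0ᵗ (pairᵗ x₁ x₂)) , x₀ ⟩² ⇒
        TermValue ⟨ x₁ , x₀ , x₃ ⟩³ ⇒ TermValue ⟨ x₂ , x₀ , x₄ ⟩³ ⇒
        not (x₃ ≈ᶠ x₄))

  clauseAxioms : FOSentence τ⁺
  clauseAxioms =
    ∀¹ (not (Clauseᵀ ⟨ 0ᵗ , x₀ ⟩²)) &
    ∀³ (Clauseᵀ ⟨ consᵗ x₁ x₂ , x₀ ⟩² ⇒ or (Literalᵀ ⟨ x₁ , x₀ ⟩²) (Clauseᵀ ⟨ x₂ , x₀ ⟩²))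

  module _ (eT eL : Rec 1) where
    -- x₁ is the node and x₀ the assignment, shifted by one under the inner quantifiers.
    nodeAxioms : FOSentence τ⁺
    nodeAxioms =
      ∀¹ (Nodeᵀ ⟨ 0ᵗ , x₀ ⟩²) &
      ∀³ (Nodeᵀ ⟨ x₁ , x₀ ⟩² ⇒ Eval eL ⟨ consᵗ x₁ 0ᵗ , pairᵗ (numeralᵗ 0) x₂ ⟩² ⇒
          Clauseᵀ ⟨ x₂ , x₀ ⟩²) &
      ∀⁴ (Nodeᵀ ⟨ x₁ , x₀ ⟩² ⇒ Eval eL ⟨ consᵗ x₁ 0ᵗ , pairᵗ (numeralᵗ 1) x₂ ⟩² ⇒
          Snoc ⟨ x₁ , 0ᵗ , x₃ ⟩³ ⇒
          exists (Domain ⟨ x₀ ⟩¹ & Nodeᵀ ⟨ x₄ , updateᵗ x₁ x₃ x₀ ⟩²)) &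
      ∀⁴ (Nodeᵀ ⟨ x₁ , x₀ ⟩² ⇒ Eval eL ⟨ consᵗ x₁ 0ᵗ , pairᵗ (numeralᵗ 2) x₂ ⟩² ⇒
          Snoc ⟨ x₁ , 0ᵗ , x₃ ⟩³ ⇒
          -- The quantifier ranges over the whole structure. This remains true in the expansion,
          -- where updating by any object stores its entry 0, an element of the original structure.
          forAll (Nodeᵀ ⟨ x₄ , updateᵗ x₁ x₃ x₀ ⟩²)) &
      ∀⁴ (Nodeᵀ ⟨ x₁ , x₀ ⟩² ⇒ Eval eL ⟨ consᵗ x₁ 0ᵗ , pairᵗ (numeralᵗ 3) 0ᵗ ⟩² ⇒
          Snoc ⟨ x₁ , x₂ , x₃ ⟩³ ⇒ Eval eT ⟨ consᵗ x₃ 0ᵗ , numeralᵗ 1 ⟩² ⇒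
          Nodeᵀ ⟨ x₃ , x₀ ⟩²)

  module _ (fin : IsFinite τ) where
    funAxiom : ∃ (Fun τ) → FOSentence τ⁺
    funAxiom (k , f) =
      ∀³ (TermsValue ⟨ x₁ , x₀ , x₂ ⟩³ ⇒
          TermValue ⟨ pairᵗ (numeralᵗ (suc (funIndex fin f))) x₁ , x₀ ,
                      app (old f) (entriesᵗ k x₂) ⟩³)

    relAxioms : ∃ (Rel τ) → FOSentence τ⁺
    relAxioms (k , R) =
      ∀³ (Literalᵀ ⟨ pairᵗ (numeralᵗ 0) (pairᵗ (numeralᵗ (suc (relIndex fin R))) x₁) , x₀ ⟩² ⇒
          TermsValue ⟨ x₁ , x₀ , x₂ ⟩³ ⇒ atom (rel (old R) (entriesᵗ k x₂))) &
      ∀³ (Literalᵀ ⟨ pairᵗ (numeralᵗ 1) (pairᵗ (numeralᵗ (suc (relIndex fin R))) x₁) , x₀ ⟩² ⇒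
          TermsValue ⟨ x₁ , x₀ , x₂ ⟩³ ⇒ not (atom (rel (old R) (entriesᵗ k x₂))))

    -- Finiteness of `τ` makes this a single sentence: the axioms for its symbols are conjoined
    -- along their enumerations.
    theory : Rec 1 → Rec 1 → FOSentence τ⁺
    theory eT eL =
      listAxioms & pairAxioms & recAxioms eT & recAxioms eL & snocAxioms &
      termAxioms & eqAxioms & clauseAxioms & nodeAxioms eT eL &
      ⋀ (funAxiom ∘ Inverse.from (fun-enum fin)) &
      ⋀ (relAxioms ∘ Inverse.from (rel-enum fin))

  -- What the axioms imply about numerals in an arbitrary `τ⁺`-structure.

  module Semantics (A : Structure τ⁺) where
    private
      module A = Structure A
      module ≈ = Setoid A.setoid
    open A using (Carrier; _≈_)

    0ᵃ : Carrier
    0ᵃ = A.fun zeroˢ []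

    sucᵃ headᵃ tailᵃ : Carrier → Carrier
    sucᵃ x  = A.fun sucˢ (x ∷ [])
    headᵃ x = A.fun headˢ (x ∷ [])
    tailᵃ x = A.fun tailˢ (x ∷ [])

    pairᵃ pushᵃ valueᵃ consᵃ : Carrier → Carrier → Carrier
    pairᵃ x y  = A.fun pairˢ (x ∷ y ∷ [])
    pushᵃ x y  = A.fun pushˢ (x ∷ y ∷ [])
    valueᵃ x y = A.fun valueˢ (x ∷ y ∷ [])
    consᵃ x y  = sucᵃ (pairᵃ x y)

    updateᵃ : Carrier → Carrier → Carrier → Carrier
    updateᵃ x y z = A.fun updateˢ (x ∷ y ∷ z ∷ [])

    suc-cong : ∀ {x y} → x ≈ y → sucᵃ x ≈ sucᵃ y
    suc-cong p = A.fun-cong sucˢ (p ∷ [])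

    cons-cong : ∀ {x x′ y y′} → x ≈ x′ → y ≈ y′ → consᵃ x y ≈ consᵃ x′ y′
    cons-cong p q = suc-cong (A.fun-cong pairˢ (p ∷ q ∷ []))

    value-congˡ : ∀ {x x′ y} → x ≈ x′ → valueᵃ x y ≈ valueᵃ x′ y
    value-congˡ p = A.fun-cong valueˢ (p ∷ ≈.refl ∷ [])

    resp² : ∀ (R : Rel⁺ 2) {x x′ y y′} → x ≈ x′ → y ≈ y′ →
            A.rel R (x ∷ y ∷ []) → A.rel R (x′ ∷ y′ ∷ [])
    resp² R p q = A.rel-resp R (p ∷ q ∷ [])

    resp³ : ∀ (R : Rel⁺ 3) {x x′ y y′ z z′} → x ≈ x′ → y ≈ y′ → z ≈ z′ →
            A.rel R (x ∷ y ∷ z ∷ []) → A.rel R (x′ ∷ y′ ∷ z′ ∷ [])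
    resp³ R p q r = A.rel-resp R (p ∷ q ∷ r ∷ [])

    numeral : ℕ → Carrier
    numeral zero    = 0ᵃ
    numeral (suc k) = sucᵃ (numeral k)

    entries : ∀ k → Carrier → Vec Carrier k
    entries zero    u = []
    entries (suc k) u = headᵃ u ∷ entries k (tailᵃ u)

    entries-cong : ∀ k {u v} → u ≈ v → Pointwise _≈_ (entries k u) (entries k v)
    entries-cong zero    p = []
    entries-cong (suc k) p = A.fun-cong headˢ (p ∷ []) ∷ entries-cong k (A.fun-cong tailˢ (p ∷ []))

    module _ {n} (ρ : Vec Carrier n) where
      ⟦numeral⟧ : ∀ k → ⟦_⟧ᵗ A (lookup ρ) (numeralᵗ k) ≡ numeral k
      ⟦numeral⟧ zero    = refl
      ⟦numeral⟧ (suc k) = cong sucᵃ (⟦numeral⟧ k)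

      ⟦entries⟧ : ∀ k t → ⟦_⟧ᵗˢ A (lookup ρ) (entriesᵗ k t) ≡ entries k (⟦_⟧ᵗ A (lookup ρ) t)
      ⟦entries⟧ zero    t = refl
      ⟦entries⟧ (suc k) t = cong (headᵃ (⟦_⟧ᵗ A (lookup ρ) t) ∷_) (⟦entries⟧ k (tailᵗ t))

    module Computation (⊨pair : A ⊨ᶠᵒ pairAxioms) where

      private
        -- Induction on the position `k` of the pair in Cantor's enumeration, stepping back as the
        -- axioms do.
        pair-numeral-at : ∀ k m n → pair m n ≡ k → pairᵃ (numeral m) (numeral n) ≈ numeral k
        pair-numeral-at k       zero    zero    refl = proj₁ ⊨pair
        pair-numeral-at zero    m       (suc n) p with () ← trans (sym (pair-suc m n)) p
        pair-numeral-at zero    (suc m) zero    p with () ← trans (sym (pair-zero m)) p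
        pair-numeral-at (suc k) m       (suc n) p =
          ≈.trans (proj₁ (proj₂ ⊨pair) _ _)
            (suc-cong (pair-numeral-at k (suc m) n (suc-injective (trans (sym (pair-suc m n)) p))))
        pair-numeral-at (suc k) (suc m) zero    p =
          ≈.trans (proj₂ (proj₂ ⊨pair) _)
            (suc-cong (pair-numeral-at k 0 m (suc-injective (trans (sym (pair-zero m)) p))))

      pair-numeral : ∀ m n → pairᵃ (numeral m) (numeral n) ≈ numeral (pair m n)
      pair-numeral m n = pair-numeral-at _ m n refl

      cons-numeral : ∀ m n → consᵃ (numeral m) (numeral n) ≈ numeral (suc (pair m n))
      cons-numeral m n = suc-cong (pair-numeral m n)

      projection : ∀ {n} (i : Fin n) → A ⊨ᶠᵒ projAxioms i → ∀ xs →
                   A.rel (Eval (proj i)) (numeral ⟨ xs ⟩ᵛ ∷ numeral (lookup xs i) ∷ [])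
      projection zero    ⊨i (x ∷ xs) =
        resp² (Eval _) (cons-numeral x ⟨ xs ⟩ᵛ) ≈.refl (⊨i _ _)
      projection (suc i) (⊨suc , ⊨i) (x ∷ xs) =
        resp² (Eval _) (cons-numeral x ⟨ xs ⟩ᵛ) ≈.refl (⊨suc _ _ _ (projection i ⊨i xs))

      mutual
        -- Induction on the run: each rule is answered by its axiom, with `cons-numeral` converting
        -- between coded lists and numerals.
        evaluate : ∀ {n} {f : Rec n} {xs y} → A ⊨ᶠᵒ recAxioms f → f [ xs ]⇓ y →
                   A.rel (Eval f) (numeral ⟨ xs ⟩ᵛ ∷ numeral y ∷ [])
        evaluate ⊨zero zero = ⊨zero
        evaluate ⊨succ (succ {x}) = resp² (Eval _) (cons-numeral x 0) ≈.refl (⊨succ _)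
        evaluate ⊨proj (proj {xs = xs}) = projection _ ⊨proj xs
        evaluate (⊨comp , ⊨f , ⊨gs) (comp gs⇓ f⇓) =
          ⊨comp _ _ _ (evaluateAll ⊨gs gs⇓) (evaluate ⊨f f⇓)
        evaluate (⊨zero , _ , ⊨f , _) (prim-zero {xs = xs} f⇓) =
          resp² (Eval _) (cons-numeral 0 ⟨ xs ⟩ᵛ) ≈.refl (⊨zero _ _ (evaluate ⊨f f⇓))
        evaluate ⊨prim@(_ , ⊨suc , _ , ⊨g) (prim-suc {xs = xs} {k} {y} r⇓ g⇓) =
          resp² (Eval _) (cons-numeral (suc k) ⟨ xs ⟩ᵛ) ≈.refl
            (⊨suc _ _ _ _
              (resp² (Eval _) (≈.sym (cons-numeral k ⟨ xs ⟩ᵛ)) ≈.refl (evaluate ⊨prim r⇓))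
              (resp² (Eval _)
                (≈.sym (≈.trans (cons-cong ≈.refl (cons-numeral y ⟨ xs ⟩ᵛ))
                                (cons-numeral k ⟨ y ∷ xs ⟩ᵛ)))
                ≈.refl (evaluate ⊨g g⇓)))
        evaluate ⊨mu@(_ , _ , ⊨mu′ , ⊨f) (mu {xs = xs} {y} f⇓ f>0) =
          ⊨mu′ _ _ (positiveBelow ⊨mu f>0 y ≤-refl)
            (resp² (Eval _) (≈.sym (cons-numeral y ⟨ xs ⟩ᵛ)) ≈.refl (evaluate ⊨f f⇓))

        -- The bound `z` climbs from 0 one axiom at a time; `z ≤ y` ensures that `f>0` covers each
        -- position passed.
        positiveBelow : ∀ {n} {f : Rec (suc n)} {xs y} → A ⊨ᶠᵒ recAxioms (mu f) →
                        (∀ z → z < y → ∃[ k ] f [ z ∷ xs ]⇓ suc k) → ∀ z → z ≤ y →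
                        A.rel (PositiveBelow f) (numeral z ∷ numeral ⟨ xs ⟩ᵛ ∷ [])
        positiveBelow (⊨zero , _) f>0 zero z≤y = ⊨zero _
        positiveBelow {xs = xs} ⊨mu@(_ , ⊨suc , _ , ⊨f) f>0 (suc z) z<y =
          ⊨suc _ _ _ (positiveBelow ⊨mu f>0 z (<⇒≤ z<y))
            (resp² (Eval _) (≈.sym (cons-numeral z ⟨ xs ⟩ᵛ)) ≈.refl
              (evaluate ⊨f (proj₂ (f>0 z z<y))))

        evaluateAll : ∀ {m n} {gs : Vec (Rec n) m} {xs ys} → A ⊨ᶠᵒ recsAxioms gs → gs [ xs ]⇓* ys →
                      A.rel (Evals gs) (numeral ⟨ xs ⟩ᵛ ∷ numeral ⟨ ys ⟩ᵛ ∷ [])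
        evaluateAll ⊨nil [] = ⊨nil _
        evaluateAll (⊨cons , ⊨g , ⊨gs) (_∷_ {y = y} {ys} g⇓ gs⇓) =
          resp² (Evals _) ≈.refl (cons-numeral y ⟨ ys ⟩ᵛ)
            (⊨cons _ _ _ (evaluate ⊨g g⇓) (evaluateAll ⊨gs gs⇓))

      evaluate¹ : ∀ {e x y} → A ⊨ᶠᵒ recAxioms e → e [ x ∷ [] ]⇓ y →
                  A.rel (Eval e) (consᵃ (numeral x) 0ᵃ ∷ numeral y ∷ [])
      evaluate¹ {x = x} ⊨e e⇓ =
        resp² (Eval _) (≈.sym (cons-numeral x 0)) ≈.refl (evaluate ⊨e e⇓)

      snoc : A ⊨ᶠᵒ snocAxioms → ∀ σ i →
             A.rel Snoc (numeral ⟨ σ ⟩ ∷ numeral i ∷ numeral ⟨ σ ∷ʳ i ⟩ ∷ [])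
      snoc (⊨nil , _) [] i = resp³ Snoc ≈.refl ≈.refl (cons-numeral i 0) (⊨nil _)
      snoc ⊨snoc@(_ , ⊨cons) (j ∷ σ) i =
        resp³ Snoc (cons-numeral j ⟨ σ ⟩) ≈.refl (cons-numeral j ⟨ σ ∷ʳ i ⟩)
          (⊨cons _ _ _ _ (snoc ⊨snoc σ i))

    -- Recursion on both positions, along the equations for `updateˢ` and `valueˢ`. The right side
    -- uses the same update as `Sat`.
    value-update : A ⊨ᶠᵒ listAxioms → ∀ i j {w b} → A.rel Domain (b ∷ []) →
                   valueᵃ (updateᵃ w (numeral i) b) (numeral j) ≈
                   ((λ k → valueᵃ w (numeral k)) [ i ≔ b ]) j
    value-update (_ , head-push , _ , value-0 , _ , update-0 , _) zero zero Pb =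
      ≈.trans (value-congˡ (update-0 _ _)) (≈.trans (value-0 _) (head-push _ _ Pb))
    value-update (_ , _ , tail-push , _ , value-suc , update-0 , _) zero (suc j) Pb =
      ≈.trans (value-congˡ (update-0 _ _))
        (≈.trans (value-suc _ _) (≈.trans (value-congˡ (tail-push _ _)) (≈.sym (value-suc _ _))))
    -- The entry pushed back is a head, and `P-head` puts it in `Domain`, as `head-push` requires.
    value-update (P-head , head-push , _ , value-0 , _ , _ , update-suc) (suc i) zero Pb =
      ≈.trans (value-congˡ (update-suc _ _ _))
        (≈.trans (value-0 _) (≈.trans (head-push _ _ (P-head _)) (≈.sym (value-0 _))))
    value-update ⊨list@(_ , _ , tail-push , _ , value-suc , _ , update-suc) (suc i) (suc j) {w} {b} Pb =
      ≈.trans (value-congˡ (update-suc _ _ _))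
        (≈.trans (value-suc _ _) (≈.trans (value-congˡ (tail-push _ _))
          (≈.trans (value-update ⊨list i j Pb) shift)))
      where
      shift : ((λ k → valueᵃ (tailᵃ w) (numeral k)) [ i ≔ b ]) j ≈
              ((λ k → valueᵃ w (numeral k)) [ suc i ≔ b ]) (suc j)
      -- `does (suc j ≟ suc i)` reduces to `does (j ≟ i)`, so one case distinction settles both
      -- sides.
      shift with does (j ≟ i)
      ... | true  = ≈.refl
      ... | false = ≈.sym (value-suc _ _)

-- Unique readability of the codes of labels, literals and atoms.

module Correctness {τ} (fin : IsFinite τ) (C : FormulaCode fin) (computable : IsComputable C) where
  open Vocabulary τ
  open Coding fin
  open FormulaCode C
  open IsComputable computable

  φ : FOSentence τ⁺
  φ = theory fin (proj₁ T-computable) (proj₁ l-computable)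

  Domainᴬ : (A : Structure τ⁺) → Pred (Structure.Carrier A) 0ℓ
  Domainᴬ A a = Structure.rel A Domain (a ∷ [])

  -- The two components of the label code, kept apart so that `pair-injective` can compare them with
  -- a given code.
  tag : ∀ {σ} → Node fin T l v σ → ℕ × ℕ
  tag (leaf ψ _ _ _) = 0 , ⟨ map codeLiteral ψ ⟩
  tag (ex i _ _ _)   = 1 , i
  tag (all i _ _ _)  = 2 , i
  tag (conj _ _)     = 3 , 0
  tag (disj _ _)     = 4 , 0

  tag-code : ∀ {σ} (nd : Node fin T l v σ) → l σ ≡ pair (proj₁ (tag nd)) (proj₂ (tag nd))
  tag-code (leaf _ _ p _) = p
  tag-code (ex _ _ p _)   = p
  tag-code (all _ _ p _)  = p
  tag-code (conj p _)     = p
  tag-code (disj p _)     = p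

  -- Once the code of a label is known, this refutes every constructor of `Node` with another tag.
  labelled : ∀ {σ} m n (nd : Node fin T l v σ) → l σ ≡ pair m n →
             proj₁ (tag nd) ≡ m × proj₂ (tag nd) ≡ n
  labelled m n nd p = pair-injective {proj₁ (tag nd)} {proj₂ (tag nd)} {m} {n} (trans (sym (tag-code nd)) p)

  -- The equation lives in `∃ (Fun τ)` so that equal indices identify the arities as well.
  funIndex-injective : ∀ {m n} (f : Fun τ m) (g : Fun τ n) → funIndex fin f ≡ funIndex fin g →
                       _≡_ {A = ∃ (Fun τ)} (m , f) (n , g)
  funIndex-injective f g p =
    trans (sym (Inverse.strictlyInverseʳ (fun-enum fin) _))
      (trans (cong (Inverse.from (fun-enum fin)) (toℕ-injective p))
             (Inverse.strictlyInverseʳ (fun-enum fin) _))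

  relIndex-injective : ∀ {m n} (R : Rel τ m) (S : Rel τ n) → relIndex fin R ≡ relIndex fin S →
                       _≡_ {A = ∃ (Rel τ)} (m , R) (n , S)
  relIndex-injective R S p =
    trans (sym (Inverse.strictlyInverseʳ (rel-enum fin) _))
      (trans (cong (Inverse.from (rel-enum fin)) (toℕ-injective p))
             (Inverse.strictlyInverseʳ (rel-enum fin) _))

  pos-code : ∀ L {a} → pair 0 a ≡ codeLiteral L → ∃[ α ] L ≡ pos α × a ≡ codeAtom α
  pos-code (pos α) {a} p = α , refl , proj₂ (pair-injective {0} {a} {0} {codeAtom α} p)
  pos-code (neg α) {a} p with () ← proj₁ (pair-injective {0} {a} {1} {codeAtom α} p)

  neg-code : ∀ L {a} → pair 1 a ≡ codeLiteral L → ∃[ α ] L ≡ neg α × a ≡ codeAtom α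
  neg-code (neg α) {a} p = α , refl , proj₂ (pair-injective {1} {a} {1} {codeAtom α} p)
  neg-code (pos α) {a} p with () ← proj₁ (pair-injective {1} {a} {0} {codeAtom α} p)

  eq-code : ∀ α {m n} → pair 0 (pair m n) ≡ codeAtom α →
            ∃[ t ] ∃[ u ] α ≡ eq t u × m ≡ codeTerm t × n ≡ codeTerm u
  eq-code (eq t u) {m} {n} p =
    t , u , refl , pair-injective {m} {n} {codeTerm t} {codeTerm u}
      (proj₂ (pair-injective {0} {pair m n} {0} {pair (codeTerm t) (codeTerm u)} p))
  eq-code (rel R ts) {m} {n} p
    with () ← proj₁ (pair-injective {0} {pair m n} {suc (relIndex fin R)} {⟨ codeTerms ts ⟩} p)

  rel-code : ∀ α {k} (R : Rel τ k) {m} → pair (suc (relIndex fin R)) m ≡ codeAtom α →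
             ∃[ ts ] α ≡ rel R ts × m ≡ ⟨ codeTerms ts ⟩
  rel-code (eq t u) R {m} p
    with () ← proj₁ (pair-injective {suc (relIndex fin R)} {m} {0} {pair (codeTerm t) (codeTerm u)} p)
  rel-code (rel S ts) R {m} p
    with index≡ , m≡ ← pair-injective {suc (relIndex fin R)} {m} {suc (relIndex fin S)} {⟨ codeTerms ts ⟩} p
    with refl ← relIndex-injective R S (suc-injective index≡) = ts , refl , m≡

  -- From a model of `φ` to the truth of the decoded sentence in its domain part.

  module Reflection
    (A : Structure τ⁺) (A⊨φ : A ⊨ᶠᵒ φ) (d : IsDomain (reduct τ⊆τ⁺ A) (Domainᴬ A))
    (B : Structure τ) (iso : B ≅ substructure (reduct τ⊆τ⁺ A) (Domainᴬ A) d)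
    where

    open Semantics A
    open _≅_ iso
    private
      module A = Structure A
      module ≈ = Setoid A.setoid
      module B = Structure B
      module ≈ᴮ = Setoid B.setoid
    open A using (Carrier; _≈_)

    ⊨list : A ⊨ᶠᵒ listAxioms
    ⊨list = let (p , _) = A⊨φ in p
    ⊨pair : A ⊨ᶠᵒ pairAxioms
    ⊨pair = let (_ , p , _) = A⊨φ in p
    ⊨eT : A ⊨ᶠᵒ recAxioms (proj₁ T-computable)
    ⊨eT = let (_ , _ , p , _) = A⊨φ in p
    ⊨eL : A ⊨ᶠᵒ recAxioms (proj₁ l-computable)
    ⊨eL = let (_ , _ , _ , p , _) = A⊨φ in p
    ⊨snoc : A ⊨ᶠᵒ snocAxioms
    ⊨snoc = let (_ , _ , _ , _ , p , _) = A⊨φ in p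
    ⊨term : A ⊨ᶠᵒ termAxioms
    ⊨term = let (_ , _ , _ , _ , _ , p , _) = A⊨φ in p
    ⊨eq : A ⊨ᶠᵒ eqAxioms
    ⊨eq = let (_ , _ , _ , _ , _ , _ , p , _) = A⊨φ in p
    ⊨clause : A ⊨ᶠᵒ clauseAxioms
    ⊨clause = let (_ , _ , _ , _ , _ , _ , _ , p , _) = A⊨φ in p
    ⊨node : A ⊨ᶠᵒ nodeAxioms (proj₁ T-computable) (proj₁ l-computable)
    ⊨node = let (_ , _ , _ , _ , _ , _ , _ , _ , p , _) = A⊨φ in p

    ⊨fun : ∀ f → A ⊨ᶠᵒ funAxiom fin f
    ⊨fun f = let (_ , _ , _ , _ , _ , _ , _ , _ , _ , p , _) = A⊨φ in
      subst (λ g → A ⊨ᶠᵒ funAxiom fin g) (Inverse.strictlyInverseʳ (fun-enum fin) f)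
        (⋀-elim {A} p (Inverse.to (fun-enum fin) f))
    ⊨rel : ∀ R → A ⊨ᶠᵒ relAxioms fin R
    ⊨rel R = let (_ , _ , _ , _ , _ , _ , _ , _ , _ , _ , p) = A⊨φ in
      subst (λ S → A ⊨ᶠᵒ relAxioms fin S) (Inverse.strictlyInverseʳ (rel-enum fin) R)
        (⋀-elim {A} p (Inverse.to (rel-enum fin) R))

    open Computation ⊨pair

    ι : B.Carrier → Carrier
    ι = proj₁ ∘ to

    ιs : ∀ {n} → Vec B.Carrier n → Vec Carrier n
    ιs = Vec.map proj₁ ∘ Vec.map to

    ι-cong : ∀ {a b} → a B.≈ b → ι a ≈ ι b
    ι-cong = Inverse.to-cong inverse

    ι-injective : ∀ {a b} → ι a ≈ ι b → a B.≈ b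
    ι-injective {a} {b} p =
      ≈ᴮ.trans (≈ᴮ.sym (Inverse.strictlyInverseʳ inverse a))
        (≈ᴮ.trans (Inverse.from-cong inverse p) (Inverse.strictlyInverseʳ inverse b))

    -- Agreement is asked at finitely many variables, since `A` need not contain an object that
    -- represents all of `s`. At the root of a sentence code the list is empty.
    Agree : List ℕ → (ℕ → B.Carrier) → Carrier → Set
    Agree is s w = ∀ {i} → i ∈ is → valueᵃ w (numeral i) ≈ ι (s i)

    pair-cong : ∀ {x x′ y y′} → x ≈ x′ → y ≈ y′ → pairᵃ x y ≈ pairᵃ x′ y′
    pair-cong p q = A.fun-cong pairˢ (p ∷ q ∷ [])

    mutual
      termValue : ∀ {s w} t → Agree (termVars t) s w →
                  A.rel TermValue (numeral (codeTerm t) ∷ w ∷ ι (⟦_⟧ᵗ B s t) ∷ [])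
      termValue (var i) p =
        resp³ TermValue (pair-numeral 0 i) ≈.refl (p (here refl)) (proj₁ ⊨term _ _)
      termValue {s} {w} (app f ts) p with u , u-value , u≈ ← termsValue ts p =
        resp³ TermValue
          (≈.trans (A.fun-cong pairˢ
                     (≈.reflexive (⟦numeral⟧ (w ∷ numeral ⟨ codeTerms ts ⟩ ∷ u ∷ []) (suc (funIndex fin f))) ∷
                      ≈.refl ∷ []))
                   (pair-numeral (suc (funIndex fin f)) ⟨ codeTerms ts ⟩))
          ≈.refl
          (≈.trans (≈.reflexive (cong (A.fun (old f)) (⟦entries⟧ (w ∷ numeral ⟨ codeTerms ts ⟩ ∷ u ∷ []) _ x₂)))
            (≈.trans (A.fun-cong (old f) u≈) (≈.sym (fun-homo f (⟦_⟧ᵗˢ B s ts)))))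
          (⊨fun (_ , f) u (numeral ⟨ codeTerms ts ⟩) w u-value)

      termsValue : ∀ {s w n} (ts : Vec (Term τ ℕ) n) → Agree (termsVars ts) s w →
                   ∃[ u ] A.rel TermsValue (numeral ⟨ codeTerms ts ⟩ ∷ w ∷ u ∷ []) ×
                          Pointwise _≈_ (entries n u) (ιs (⟦_⟧ᵗˢ B s ts))
      -- An arbitrary witness, none of whose entries are inspected.
      termsValue [] p = 0ᵃ , proj₁ (proj₂ ⊨term) _ _ , []
      termsValue {s} (t ∷ ts) p
        with u , u-value , u≈ ← termsValue ts (p ∘ ∈-++⁺ʳ (termVars t)) =
        pushᵃ (ι (⟦_⟧ᵗ B s t)) u ,
        resp³ TermsValue (cons-numeral (codeTerm t) ⟨ codeTerms ts ⟩) ≈.refl ≈.refl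
          (proj₂ (proj₂ ⊨term) _ _ _ _ _ (termValue t (p ∘ ∈-++⁺ˡ)) u-value) ,
        -- The head of a pushed sequence is controlled for elements of `Domain`, where `ι` takes its
        -- values.
        proj₁ (proj₂ ⊨list) _ _ (proj₂ (to (⟦_⟧ᵗ B s t))) ∷
        Pointwise.trans ≈.trans (entries-cong _ (proj₁ (proj₂ (proj₂ ⊨list)) _ _)) u≈

    entries≈ : ∀ {n k t} {ρ : Vec Carrier k} {xs : Vec Carrier n} →
               Pointwise _≈_ (entries n (⟦_⟧ᵗ A (lookup ρ) t)) xs →
               Pointwise _≈_ (⟦_⟧ᵗˢ A (lookup ρ) (entriesᵗ n t)) xs
    entries≈ {n} {t = t} {ρ} = subst (λ ys → Pointwise _≈_ ys _) (sym (⟦entries⟧ ρ n t))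

    eq-numeral : ∀ m t u →
              pairᵃ (numeral m) (pairᵃ 0ᵃ (pairᵃ (numeral (codeTerm t)) (numeral (codeTerm u)))) ≈
              numeral (pair m (codeAtom (eq t u)))
    eq-numeral m t u =
      ≈.trans (pair-cong ≈.refl
                (≈.trans (pair-cong ≈.refl (pair-numeral (codeTerm t) (codeTerm u)))
                         (pair-numeral 0 (pair (codeTerm t) (codeTerm u)))))
              (pair-numeral m (codeAtom (eq t u)))

    rel-numeral : ∀ m {n k} (R : Rel τ n) (ts : Vec (Term τ ℕ) n) {ρ : Vec Carrier k} →
               pairᵃ (numeral m) (pairᵃ (⟦_⟧ᵗ A (lookup ρ) (numeralᵗ (suc (relIndex fin R))))
                                        (numeral ⟨ codeTerms ts ⟩)) ≈
               numeral (pair m (codeAtom (rel R ts)))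
    rel-numeral m R ts {ρ} =
      ≈.trans (pair-cong ≈.refl
                (≈.trans (pair-cong (≈.reflexive (⟦numeral⟧ ρ (suc (relIndex fin R)))) ≈.refl)
                         (pair-numeral (suc (relIndex fin R)) ⟨ codeTerms ts ⟩)))
              (pair-numeral m (codeAtom (rel R ts)))

    -- The axioms give the atom or its negation in `A` at the `ι`-images of the term values; the
    -- isomorphism carries this back to `B`.
    literal : ∀ {s w} L → Agree (literalVars L) s w →
              A.rel Literalᵀ (numeral (codeLiteral L) ∷ w ∷ []) → LiteralSat B s L
    literal (pos (eq t u)) p L =
      ι-injective (proj₁ ⊨eq _ _ _ _ _ (resp² Literalᵀ (≈.sym (eq-numeral 0 t u)) ≈.refl L)
        (termValue t (p ∘ ∈-++⁺ˡ)) (termValue u (p ∘ ∈-++⁺ʳ (termVars t)))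
        (proj₂ (to _)) (proj₂ (to _)))
    literal (neg (eq t u)) p L t≈u =
      proj₂ ⊨eq _ _ _ _ _ (resp² Literalᵀ (≈.sym (eq-numeral 1 t u)) ≈.refl L)
        (termValue t (p ∘ ∈-++⁺ˡ)) (termValue u (p ∘ ∈-++⁺ʳ (termVars t))) (ι-cong t≈u)
    literal {s} {w} (pos (rel R ts)) p L with u , u-value , u≈ ← termsValue ts p =
      Equivalence.from (rel-iso R _)
        (A.rel-resp (old R) (entries≈ {t = x₂} {w ∷ numeral ⟨ codeTerms ts ⟩ ∷ u ∷ []} u≈)
          (proj₁ (⊨rel (_ , R)) u (numeral ⟨ codeTerms ts ⟩) w
            (resp² Literalᵀ (≈.sym (rel-numeral 0 R ts {w ∷ numeral ⟨ codeTerms ts ⟩ ∷ u ∷ []})) ≈.refl L) u-value))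
    literal {s} {w} (neg (rel R ts)) p L r with u , u-value , u≈ ← termsValue ts p =
      proj₂ (⊨rel (_ , R)) u (numeral ⟨ codeTerms ts ⟩) w
        (resp² Literalᵀ (≈.sym (rel-numeral 1 R ts {w ∷ numeral ⟨ codeTerms ts ⟩ ∷ u ∷ []})) ≈.refl L) u-value
        (A.rel-resp (old R) (Pointwise.sym ≈.sym (entries≈ {t = x₂} {w ∷ numeral ⟨ codeTerms ts ⟩ ∷ u ∷ []} u≈))
          (Equivalence.to (rel-iso R _) r))

    clauseᵀ : ∀ {s w} ψ → Agree (clauseVars ψ) s w →
              A.rel Clauseᵀ (numeral ⟨ map codeLiteral ψ ⟩ ∷ w ∷ []) → Any (LiteralSat B s) ψ
    clauseᵀ []      p c = ⊥-elim (proj₁ ⊨clause _ c)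
    clauseᵀ (L ∷ ψ) p c
      with proj₂ ⊨clause _ _ _
             (resp² Clauseᵀ (≈.sym (cons-numeral (codeLiteral L) ⟨ map codeLiteral ψ ⟩)) ≈.refl c)
    ... | inj₁ h = here (literal L (p ∘ ∈-++⁺ˡ) h)
    ... | inj₂ t = there (clauseᵀ ψ (p ∘ ∈-++⁺ʳ (literalVars L)) t)

    -- Used with `js` the free variables of a child and `is` those of the quantified node: apart
    -- from the bound `i`, the former are among the latter.
    agree-update : ∀ {is js s w b a i} → A.rel Domain (b ∷ []) → b ≈ ι a →
                   (∀ {j} → j ∈ js → j ≢ i → j ∈ is) → Agree is s w →
                   Agree js (s [ i ≔ a ]) (updateᵃ w (numeral i) b)
    agree-update {s = s} {w} {b} {a} {i} Pb b≈a js⊆is p {j} j∈js =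
      ≈.trans (value-update ⊨list i j Pb) (compare (j ≟ i))
      where
      compare : (d : Dec (j ≡ i)) →
                (if does d then b else valueᵃ w (numeral j)) ≈ ι (if does d then a else s j)
      compare (yes _)  = b≈a
      compare (no j≢i) = p (js⊆is j∈js j≢i)

    label : ∀ {σ} m n → T σ → l σ ≡ pair m n →
            A.rel (Eval (proj₁ l-computable))
                  (consᵃ (numeral ⟨ σ ⟩) 0ᵃ ∷ pairᵃ (numeral m) (numeral n) ∷ [])
    label m n p lσ≡ =
      resp² (Eval _) ≈.refl (≈.trans (≈.reflexive (cong numeral lσ≡)) (≈.sym (pair-numeral m n)))
        (evaluate¹ ⊨eL (proj₂ l-computable p))

    child : ∀ {σ} → T σ →
            A.rel (Eval (proj₁ T-computable)) (consᵃ (numeral ⟨ σ ⟩) 0ᵃ ∷ numeral 1 ∷ [])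
    child {σ} p with proj₂ T-computable σ
    ... | yes _ , e⇓ = evaluate¹ ⊨eT e⇓
    ... | no ¬p , _  = contradiction p ¬p

    -- Recursion on the accessibility of `σ`. Each step goes to a child that really lies in `T` and
    -- whose code is a numeral, so that labels, membership and `Snoc` are all supplied by actual
    -- computations.
    reflect : No⋁⋁ → ∀ {σ} (p : T σ) (a : Acc ChildOf σ) {s w} → Agree (v σ) s w →
              A.rel Nodeᵀ (numeral ⟨ σ ⟩ ∷ w ∷ []) → Sat B s (decodeAt p a)
    reflect no⋁⋁ {σ} p (acc rs) agree σᵀ with node p | ⊨node
    ... | leaf ψ _ lσ vσ | _ , ⊨leaf , _ =
      clauseᵀ ψ (agree ∘ proj₂ vσ) (⊨leaf _ _ _ σᵀ (label 0 ⟨ map codeLiteral ψ ⟩ p lσ))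
    ... | ex i _ lσ vσ | _ , _ , ⊨ex , _
      with b , Pb , childᵀ ← ⊨ex _ _ _ _ σᵀ (label 1 i p lσ) (snoc ⊨snoc σ 0) =
      -- The axiom relativizes its witness to `Domain`, so it comes from an element of `B`.
      from (b , Pb) ,
      reflect no⋁⋁ _ (rs _)
        (agree-update Pb (≈.sym (Inverse.strictlyInverseˡ inverse (b , Pb)))
          (λ j∈ j≢i → proj₂ vσ (j∈ , j≢i)) agree)
        childᵀ
    ... | all i _ lσ vσ | _ , _ , _ , ⊨all , _ = λ a →
      reflect no⋁⋁ _ (rs _)
        (agree-update (proj₂ (to a)) ≈.refl (λ j∈ j≢i → proj₂ vσ (j∈ , j≢i)) agree)
        (⊨all _ _ _ _ σᵀ (label 2 i p lσ) (snoc ⊨snoc σ 0) (ι a))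
    -- All children share `w`. The program for `T` really returns 1 at `σ ∷ʳ i`, which triggers the
    -- axiom.
    ... | conj lσ vσ | _ , _ , _ , _ , ⊨conj = λ i q →
      reflect no⋁⋁ q (rs _) (λ j∈ → agree (proj₂ vσ (i , q , j∈)))
        (⊨conj _ _ _ _ σᵀ (label 3 0 p lσ) (snoc ⊨snoc σ i) (child q))
    ... | disj lσ _ | _ = contradiction lσ (no⋁⋁ p)

    reflects : IsSentenceCode → No⋁⋁ → B ⊨ decode
    reflects closed no⋁⋁ s =
      reflect no⋁⋁ root (wellFounded [])
        -- With no free variables at the root, `0ᵃ` agrees vacuously with the arbitrary `s`.
        (λ {i} i∈ → contradiction (subst (i ∈_) closed i∈) λ ()) (proj₁ ⊨node 0ᵃ)

  -- The expansion of a `τ`-structure `B` to numbers and sequences.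

  module Expansion (B : Structure τ) where
    private
      module B = Structure B
      module ≈ᴮ = Setoid B.setoid

    infix 4 _≋_
    _≋_ : (ℕ → B.Carrier) → (ℕ → B.Carrier) → Set
    s ≋ t = ∀ i → s i B.≈ t i

    -- A pair serves as a number, as a sequence and, by its entry 0, as an element of B;
    -- the elements satisfying Domain are the constant sequences with number 0.
    D : Set
    D = ℕ × (ℕ → B.Carrier)

    num : D → ℕ
    num = proj₁

    env : D → ℕ → B.Carrier
    env = proj₂

    el : D → B.Carrier
    el d = env d 0

    ⌊_⌋ : ℕ → D
    ⌊ n ⌋ = n , const B.point

    push : B.Carrier → (ℕ → B.Carrier) → ℕ → B.Carrier
    push a s zero    = a
    push a s (suc i) = s i

    prefix : ∀ k → (ℕ → B.Carrier) → Vec B.Carrier k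
    prefix zero    s = []
    prefix (suc k) s = s 0 ∷ prefix k (s ∘ suc)

    _≈ᴰ_ : D → D → Set
    d ≈ᴰ e = num d ≡ num e × env d ≋ env e

    setoidᴰ : Setoid 0ℓ 0ℓ
    setoidᴰ = record
      { Carrier = D
      ; _≈_ = _≈ᴰ_
      ; isEquivalence = record
        { refl  = refl , λ _ → ≈ᴮ.refl
        ; sym   = λ (p , q) → sym p , λ i → ≈ᴮ.sym (q i)
        ; trans = λ (p , q) (p′ , q′) → trans p p′ , λ i → ≈ᴮ.trans (q i) (q′ i)
        }
      }

    update-cong : ∀ {s t a b} i → s ≋ t → a B.≈ b → s [ i ≔ a ] ≋ t [ i ≔ b ]
    update-cong i p q j with does (j ≟ i)
    ... | true  = q
    ... | false = p j

    push-cong : ∀ {s t a b} → a B.≈ b → s ≋ t → push a s ≋ push b t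
    push-cong p q zero    = p
    push-cong p q (suc i) = q i

    prefix-cong : ∀ k {s t} → s ≋ t → Pointwise B._≈_ (prefix k s) (prefix k t)
    prefix-cong zero    p = []
    prefix-cong (suc k) p = p 0 ∷ prefix-cong k (p ∘ suc)

    els-cong : ∀ {n} {ds es : Vec D n} → Pointwise _≈ᴰ_ ds es →
               Pointwise B._≈_ (Vec.map el ds) (Vec.map el es)
    els-cong = Pointwise.map⁺ λ (_ , p) → p 0

    -- Numerical results carry the default sequence `const B.point`. Results that are elements of
    -- `B` are constant sequences with number 0, so `Domain` is closed under the symbols of `τ`. The
    -- operations with sequence results keep the number, as `tailᵗ (pushᵗ x₀ x₁) ≈ᶠ x₁` demands.
    funᴰ : ∀ {n} → Fun⁺ n → Vec D n → D
    funᴰ (old f) ds               = 0 , const (B.fun f (Vec.map el ds))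
    funᴰ zeroˢ   []               = ⌊ 0 ⌋
    funᴰ sucˢ    (x ∷ [])         = ⌊ suc (num x) ⌋
    funᴰ headˢ   (u ∷ [])         = 0 , const (el u)
    funᴰ tailˢ   (u ∷ [])         = num u , env u ∘ suc
    funᴰ pairˢ   (x ∷ y ∷ [])     = ⌊ pair (num x) (num y) ⌋
    funᴰ pushˢ   (b ∷ u ∷ [])     = num u , push (el b) (env u)
    funᴰ valueˢ  (w ∷ i ∷ [])     = 0 , const (env w (num i))
    funᴰ updateˢ (w ∷ i ∷ b ∷ []) = num w , env w [ num i ≔ el b ]

    funᴰ-cong : ∀ {n} (f : Fun⁺ n) {ds es} → Pointwise _≈ᴰ_ ds es → funᴰ f ds ≈ᴰ funᴰ f es
    funᴰ-cong (old f) ps = refl , λ _ → B.fun-cong f (els-cong ps)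
    funᴰ-cong zeroˢ   [] = refl , λ _ → ≈ᴮ.refl
    funᴰ-cong sucˢ    ((p , _) ∷ []) = cong suc p , λ _ → ≈ᴮ.refl
    funᴰ-cong headˢ   ((_ , p) ∷ []) = refl , λ _ → p 0
    funᴰ-cong tailˢ   ((p , q) ∷ []) = p , q ∘ suc
    funᴰ-cong pairˢ   ((p , _) ∷ (q , _) ∷ []) = cong₂ pair p q , λ _ → ≈ᴮ.refl
    funᴰ-cong pushˢ   ((_ , p) ∷ (q , r) ∷ []) = q , push-cong (p 0) r
    funᴰ-cong valueˢ  {_} {_ ∷ (i , _) ∷ []} ((_ , p) ∷ (refl , _) ∷ []) = refl , λ _ → p i
    funᴰ-cong updateˢ {_} {_ ∷ (i , _) ∷ _ ∷ []} ((p , q) ∷ (refl , _) ∷ (_ , r) ∷ []) =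
      p , update-cong i q (r 0)

    -- Where it quantifies over all lists or terms with the given code, the relation holds
    -- vacuously at numbers that code none, as the Horn axioms require.  The slack s ≋ env w makes the
    -- relations respect equality without a congruence lemma for Sat.
    relᴰ : ∀ {n} → Rel⁺ n → Vec D n → Set
    relᴰ (old R)           ds               = B.rel R (Vec.map el ds)
    relᴰ Domain            (d ∷ [])         = num d ≡ 0 × env d ≋ const (el d)
    relᴰ (Eval f)          (x ∷ y ∷ [])     = ∀ xs → num x ≡ ⟨ xs ⟩ᵛ → f [ xs ]⇓ num y
    relᴰ (Evals gs)        (x ∷ y ∷ [])     =
      ∀ xs → num x ≡ ⟨ xs ⟩ᵛ → ∃[ ys ] num y ≡ ⟨ ys ⟩ᵛ × gs [ xs ]⇓* ys
    relᴰ (PositiveBelow f) (y ∷ x ∷ [])     =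
      ∀ xs → num x ≡ ⟨ xs ⟩ᵛ → ∀ z → z < num y → ∃[ k ] f [ z ∷ xs ]⇓ suc k
    relᴰ TermValue         (n ∷ w ∷ b ∷ []) =
      ∀ t s → s ≋ env w → num n ≡ codeTerm t → el b B.≈ ⟦_⟧ᵗ B s t
    relᴰ TermsValue        (n ∷ w ∷ u ∷ []) =
      ∀ {k} (ts : Vec (Term τ ℕ) k) s → s ≋ env w → num n ≡ ⟨ codeTerms ts ⟩ →
      Pointwise B._≈_ (prefix k (env u)) (⟦_⟧ᵗˢ B s ts)
    relᴰ Literalᵀ          (n ∷ w ∷ [])     =
      ∃[ L ] ∃[ s ] s ≋ env w × num n ≡ codeLiteral L × LiteralSat B s L
    relᴰ Clauseᵀ           (n ∷ w ∷ [])     =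
      ∃[ ψ ] ∃[ s ] s ≋ env w × num n ≡ ⟨ map codeLiteral ψ ⟩ × Any (LiteralSat B s) ψ
    relᴰ Snoc              (x ∷ i ∷ y ∷ []) = ∀ σ → num x ≡ ⟨ σ ⟩ → num y ≡ ⟨ σ ∷ʳ num i ⟩
    -- The proofs `p` and `a` belong to the witness because `decodeAt` takes them as arguments; a
    -- child then comes with the very proofs that decoding its parent produces.
    relᴰ Nodeᵀ             (x ∷ w ∷ [])     =
      ∃[ σ ] ∃[ s ] s ≋ env w × num x ≡ ⟨ σ ⟩ ×
      Σ[ p ∈ T σ ] Σ[ a ∈ Acc ChildOf σ ] Sat B s (decodeAt p a)

    ≋-trans : ∀ {s t r} → s ≋ t → t ≋ r → s ≋ r
    ≋-trans p q i = ≈ᴮ.trans (p i) (q i)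

    ≋-sym : ∀ {s t} → s ≋ t → t ≋ s
    ≋-sym p i = ≈ᴮ.sym (p i)

    relᴰ-resp : ∀ {n} (R : Rel⁺ n) {ds es} → Pointwise _≈ᴰ_ ds es → relᴰ R ds → relᴰ R es
    relᴰ-resp (old R) ps r = B.rel-resp R (els-cong ps) r
    relᴰ-resp Domain ((p , q) ∷ []) (d≡0 , r) =
      trans (sym p) d≡0 , λ i → ≈ᴮ.trans (≈ᴮ.sym (q i)) (≈ᴮ.trans (r i) (q 0))
    relᴰ-resp (Eval f) ((refl , _) ∷ (refl , _) ∷ []) r = r
    relᴰ-resp (Evals gs) ((refl , _) ∷ (refl , _) ∷ []) r = r
    relᴰ-resp (PositiveBelow f) ((refl , _) ∷ (refl , _) ∷ []) r = r
    relᴰ-resp TermValue ((refl , _) ∷ (_ , p) ∷ (_ , q) ∷ []) r = λ t s s≋ n≡ →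
      ≈ᴮ.trans (≈ᴮ.sym (q 0)) (r t s (≋-trans s≋ (≋-sym p)) n≡)
    relᴰ-resp TermsValue ((refl , _) ∷ (_ , p) ∷ (_ , q) ∷ []) r = λ ts s s≋ n≡ →
      Pointwise.trans ≈ᴮ.trans (prefix-cong _ (≋-sym q)) (r ts s (≋-trans s≋ (≋-sym p)) n≡)
    relᴰ-resp Literalᵀ ((refl , _) ∷ (_ , p) ∷ []) (L , s , s≋ , r) = L , s , ≋-trans s≋ p , r
    relᴰ-resp Clauseᵀ ((refl , _) ∷ (_ , p) ∷ []) (ψ , s , s≋ , r) = ψ , s , ≋-trans s≋ p , r
    relᴰ-resp Snoc ((refl , _) ∷ (refl , _) ∷ (refl , _) ∷ []) r = r
    relᴰ-resp Nodeᵀ ((refl , _) ∷ (_ , p) ∷ []) (σ , s , s≋ , r) = σ , s , ≋-trans s≋ p , r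

    A : Structure τ⁺
    A = record
      { setoid   = setoidᴰ
      ; fun      = funᴰ
      ; fun-cong = funᴰ-cong
      ; rel      = relᴰ
      ; rel-resp = relᴰ-resp
      ; point    = ⌊ 0 ⌋
      }

    domain : IsDomain (reduct τ⊆τ⁺ A) (Domainᴬ A)
    domain = record
      { nonempty = ⌊ 0 ⌋ , refl , λ _ → ≈ᴮ.refl
      ; closed   = λ _ _ → refl , λ _ → ≈ᴮ.refl
      }

    embed : B.Carrier → ∃ (Domainᴬ A)
    embed b = (0 , const b) , refl , λ _ → ≈ᴮ.refl

    els-embed : ∀ {n} (bs : Vec B.Carrier n) → Vec.map el (Vec.map proj₁ (Vec.map embed bs)) ≡ bs
    els-embed []       = refl
    els-embed (b ∷ bs) = cong (b ∷_) (els-embed bs)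

    isomorphism : B ≅ substructure (reduct τ⊆τ⁺ A) (Domainᴬ A) domain
    isomorphism = record
      { inverse = record
        { to        = embed
        ; from      = el ∘ proj₁
        ; to-cong   = λ p → refl , λ _ → p
        ; from-cong = λ (_ , p) → p 0
        ; inverse   = (λ {(_ , d≡0 , d≋)} p →
                        sym d≡0 , λ i → ≈ᴮ.trans p (≈ᴮ.sym (d≋ i)))
                    , λ (_ , p) → p 0
        }
      ; fun-homo = λ f bs → refl , λ _ → ≈ᴮ.reflexive (cong (B.fun f) (sym (els-embed bs)))
      ; rel-iso  = λ R bs → mk⇔ (subst (B.rel R) (sym (els-embed bs))) (subst (B.rel R) (els-embed bs))
      }

    -- The axioms hold in the expansion.

    num-numeral : ∀ {n} (ρ : Vec D n) k → num (⟦_⟧ᵗ A (lookup ρ) (numeralᵗ k)) ≡ k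
    num-numeral ρ zero    = refl
    num-numeral ρ (suc k) = cong suc (num-numeral ρ k)

    els-entries : ∀ {n} (ρ : Vec D n) k t →
                  Vec.map el (⟦_⟧ᵗˢ A (lookup ρ) (entriesᵗ k t)) ≡ prefix k (env (⟦_⟧ᵗ A (lookup ρ) t))
    els-entries ρ zero    t = refl
    els-entries ρ (suc k) t = cong (el (⟦_⟧ᵗ A (lookup ρ) t) ∷_) (els-entries ρ k (tailᵗ t))

    ⊨list : A ⊨ᶠᵒ listAxioms
    ⊨list =
      (λ _ → refl , λ _ → ≈ᴮ.refl) ,
      (λ _ _ (b≡0 , b≋) → sym b≡0 , λ i → ≈ᴮ.sym (b≋ i)) ,
      (λ _ _ → refl , λ _ → ≈ᴮ.refl) ,
      (λ _ → refl , λ _ → ≈ᴮ.refl) ,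
      (λ _ _ → refl , λ _ → ≈ᴮ.refl) ,
      (λ _ _ → refl , λ { zero → ≈ᴮ.refl ; (suc _) → ≈ᴮ.refl }) ,
      (λ _ _ _ → refl , λ { zero → ≈ᴮ.refl ; (suc _) → ≈ᴮ.refl })

    ⊨pair : A ⊨ᶠᵒ pairAxioms
    ⊨pair =
      (refl , λ _ → ≈ᴮ.refl) ,
      (λ m n → pair-suc (num m) (num n) , λ _ → ≈ᴮ.refl) ,
      (λ n → pair-zero (num n) , λ _ → ≈ᴮ.refl)

    ⊨proj : ∀ {n} (i : Fin n) → A ⊨ᶠᵒ projAxioms i
    ⊨proj zero x xs (y ∷ ys) p with refl , _ ← cons-injective {num x} {num xs} y ys p = proj
    ⊨proj (suc i) =
      (λ { y xs x xs⇓ (z ∷ zs) p → proj-suc (xs⇓ zs (proj₂ (cons-injective {num x} {num xs} z zs p))) }) ,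
      ⊨proj i

    mutual
      -- Each axiom turns back into the rule of `_[_]⇓_` that it came from, after reading the coded
      -- argument list.
      ⊨rec : ∀ {n} (f : Rec n) → A ⊨ᶠᵒ recAxioms f
      ⊨rec zero [] _ = zero
      ⊨rec succ x (y ∷ []) p with refl , _ ← cons-injective {num x} {0} y [] p = succ
      ⊨rec (proj i) = ⊨proj i
      ⊨rec (comp f gs) =
        -- `f⇓` applies only if the intermediate number codes a vector, which is why `Evals` asserts
        -- that `vs` exists.
        (λ z ys x gs⇓ f⇓ xs p → let (vs , q , gs⇓vs) = gs⇓ xs p in comp gs⇓vs (f⇓ vs q)) ,
        ⊨rec f , ⊨recs gs
      ⊨rec (prim f g) =
        (λ { y xs f⇓ (v ∷ vs) p → prim-base {m = v} (cons-injective {0} {num xs} v vs p) (f⇓ vs) }) ,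
        (λ { z y k xs r⇓ g⇓ (v ∷ vs) p →
             prim-step (cons-injective {suc (num k)} {num xs} v vs p)
               (λ q → r⇓ (num k ∷ vs) (cons-code (num k) q))
               (λ q → g⇓ (num k ∷ num y ∷ vs)
                        (cons-code {xs = num y ∷ vs} (num k) (cons-code (num y) q))) }) ,
        ⊨rec f , ⊨rec g
      ⊨rec (mu f) =
        (λ _ _ _ _ ()) ,
        (λ k y x below f⇓ xs p z z<1+y →
          positive-step xs (below xs p) (num k , f⇓ (num y ∷ xs) (cons-code (num y) p)) z z<1+y) ,
        (λ y x below f⇓ xs p → mu (f⇓ (num y ∷ xs) (cons-code (num y) p)) (below xs p)) ,
        ⊨rec f

      ⊨recs : ∀ {m n} (gs : Vec (Rec n) m) → A ⊨ᶠᵒ recsAxioms gs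
      ⊨recs []       = λ _ _ _ → [] , refl , []
      ⊨recs (g ∷ gs) =
        (λ ys y x g⇓ gs⇓ xs p → let (vs , q , gs⇓vs) = gs⇓ xs p in
          num y ∷ vs , cons-code (num y) q , g⇓ xs p ∷ gs⇓vs) ,
        ⊨rec g , ⊨recs gs

    ⊨snoc : A ⊨ᶠᵒ snocAxioms
    ⊨snoc =
      (λ { _ [] _ → refl }) ,
      (λ { j y i x xi (k ∷ σ) p → snoc-step {num j} {num x} {k} σ p (xi σ) })
      where
      snoc-step : ∀ {j x k y i} σ → suc (pair j x) ≡ ⟨ k ∷ σ ⟩ →
                  (x ≡ ⟨ σ ⟩ → y ≡ ⟨ σ ∷ʳ i ⟩) → suc (pair j y) ≡ ⟨ k ∷ σ ∷ʳ i ⟩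
      snoc-step {j} {x} {k} σ p q =
        let (j≡k , x≡σ) = pair-injective {j} {x} {k} {⟨ σ ⟩} (suc-injective p)
        in cong₂ (λ a b → suc (pair a b)) j≡k (q x≡σ)

    ⊨term : A ⊨ᶠᵒ termAxioms
    ⊨term = ⊨var , (λ { _ _ [] _ _ _ → [] }) , ⊨cons
      where
      ⊨var : ∀ i w t s → s ≋ env w → pair 0 (num i) ≡ codeTerm t → env w (num i) B.≈ ⟦_⟧ᵗ B s t
      ⊨var i w (var j) s s≋ p
        with refl ← proj₂ (pair-injective {0} {num i} {0} {j} p) = ≈ᴮ.sym (s≋ (num i))
      ⊨var i w (app f ts) s s≋ p
        with () ← proj₁ (pair-injective {0} {num i} {suc (funIndex fin f)} {⟨ codeTerms ts ⟩} p)

      ⊨cons : ∀ u m b n w → relᴰ TermValue (n ∷ w ∷ b ∷ []) → relᴰ TermsValue (m ∷ w ∷ u ∷ []) →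
              ∀ {k} (ts : Vec (Term τ ℕ) k) s → s ≋ env w →
              suc (pair (num n) (num m)) ≡ ⟨ codeTerms ts ⟩ →
              Pointwise B._≈_ (prefix k (push (el b) (env u))) (⟦_⟧ᵗˢ B s ts)
      ⊨cons u m b n w t-value ts-value (t ∷ ts) s s≋ p =
        let (n≡ , m≡) = pair-injective {num n} {num m} {codeTerm t} {⟨ codeTerms ts ⟩} (suc-injective p)
        in t-value t s s≋ n≡ ∷ ts-value ts s s≋ m≡

    -- Only applications of `f` itself can have the code in question: variables have tag 0, and the
    -- index determines symbol and arity.
    ⊨fun : ∀ f → A ⊨ᶠᵒ funAxiom fin f
    ⊨fun (k , f) u m w ts-value (var i) s s≋ p
      with () ← proj₁ (pair-injective
        {suc (num (⟦_⟧ᵗ A (lookup (w ∷ m ∷ u ∷ [])) (numeralᵗ (funIndex fin f))))} {num m} {0} {i} p)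
    ⊨fun (k , f) u m w ts-value (app g ts) s s≋ p
      with index≡ , m≡ ← pair-injective
        {suc (num (⟦_⟧ᵗ A (lookup (w ∷ m ∷ u ∷ [])) (numeralᵗ (funIndex fin f))))} {num m}
        {suc (funIndex fin g)} {⟨ codeTerms ts ⟩} p
      with refl ← funIndex-injective f g
                    (trans (sym (num-numeral (w ∷ m ∷ u ∷ []) (funIndex fin f))) (suc-injective index≡))
      = B.fun-cong f (subst (λ xs → Pointwise B._≈_ xs _)
                       (sym (els-entries (w ∷ m ∷ u ∷ []) k x₂)) (ts-value ts s s≋ m≡))

    ⊨eq : A ⊨ᶠᵒ eqAxioms
    ⊨eq = ⊨pos , ⊨neg
      where
      ⊨pos : ∀ c b u t w → ∃[ L ] ∃[ s ] s ≋ env w ×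
               pair 0 (pair 0 (pair (num t) (num u))) ≡ codeLiteral L × LiteralSat B s L →
             relᴰ TermValue (t ∷ w ∷ b ∷ []) → relᴰ TermValue (u ∷ w ∷ c ∷ []) →
             relᴰ Domain (b ∷ []) → relᴰ Domain (c ∷ []) → b ≈ᴰ c
      ⊨pos c b u t w (L , s , s≋ , p , sat) t-value u-value (b≡0 , b≋) (c≡0 , c≋)
        with α , refl , q ← pos-code L {pair 0 (pair (num t) (num u))} p
        with t′ , u′ , refl , t≡ , u≡ ← eq-code α {num t} {num u} q =
        -- The term values give equality at entry 0; membership in `Domain` extends it to the
        -- numbers and to all entries.
        trans b≡0 (sym c≡0) , λ i →
          ≈ᴮ.trans (b≋ i) (≈ᴮ.trans (≈ᴮ.trans (t-value t′ s s≋ t≡) sat)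
            (≈ᴮ.trans (≈ᴮ.sym (u-value u′ s s≋ u≡)) (≈ᴮ.sym (c≋ i))))

      ⊨neg : ∀ c b u t w → ∃[ L ] ∃[ s ] s ≋ env w ×
               pair 1 (pair 0 (pair (num t) (num u))) ≡ codeLiteral L × LiteralSat B s L →
             relᴰ TermValue (t ∷ w ∷ b ∷ []) → relᴰ TermValue (u ∷ w ∷ c ∷ []) → ¬ b ≈ᴰ c
      ⊨neg c b u t w (L , s , s≋ , p , sat) t-value u-value (_ , b≈c)
        with α , refl , q ← neg-code L {pair 0 (pair (num t) (num u))} p
        with t′ , u′ , refl , t≡ , u≡ ← eq-code α {num t} {num u} q =
        sat (≈ᴮ.trans (≈ᴮ.sym (t-value t′ s s≋ t≡)) (≈ᴮ.trans (b≈c 0) (u-value u′ s s≋ u≡)))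

    ⊨rel : ∀ R → A ⊨ᶠᵒ relAxioms fin R
    ⊨rel (k , R) = ⊨pos , ⊨neg
      where
      index : D → D → D → ℕ
      index u m w = num (⟦_⟧ᵗ A (lookup (w ∷ m ∷ u ∷ [])) (numeralᵗ (relIndex fin R)))

      entries≈ : ∀ u m w {s} {ts : Vec (Term τ ℕ) k} → Pointwise B._≈_ (prefix k (env u)) (⟦_⟧ᵗˢ B s ts) →
                 Pointwise B._≈_ (Vec.map el (⟦_⟧ᵗˢ A (lookup (w ∷ m ∷ u ∷ [])) (entriesᵗ k x₂))) (⟦_⟧ᵗˢ B s ts)
      entries≈ u m w = subst (λ xs → Pointwise B._≈_ xs _) (sym (els-entries (w ∷ m ∷ u ∷ []) k x₂))

      ⊨pos : ∀ u m w → ∃[ L ] ∃[ s ] s ≋ env w ×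
               pair 0 (pair (suc (index u m w)) (num m)) ≡ codeLiteral L × LiteralSat B s L →
             relᴰ TermsValue (m ∷ w ∷ u ∷ []) →
             B.rel R (Vec.map el (⟦_⟧ᵗˢ A (lookup (w ∷ m ∷ u ∷ [])) (entriesᵗ k x₂)))
      ⊨pos u m w (L , s , s≋ , p , sat) ts-value
        with α , refl , q ← pos-code L {pair (suc (index u m w)) (num m)} p
        with ts , refl , m≡ ← rel-code α R {num m}
               (trans (cong (λ i → pair (suc i) (num m)) (sym (num-numeral (w ∷ m ∷ u ∷ []) (relIndex fin R)))) q) =
        B.rel-resp R (Pointwise.sym ≈ᴮ.sym (entries≈ u m w (ts-value ts s s≋ m≡))) sat

      ⊨neg : ∀ u m w → ∃[ L ] ∃[ s ] s ≋ env w ×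
               pair 1 (pair (suc (index u m w)) (num m)) ≡ codeLiteral L × LiteralSat B s L →
             relᴰ TermsValue (m ∷ w ∷ u ∷ []) →
             ¬ B.rel R (Vec.map el (⟦_⟧ᵗˢ A (lookup (w ∷ m ∷ u ∷ [])) (entriesᵗ k x₂)))
      ⊨neg u m w (L , s , s≋ , p , sat) ts-value r
        with α , refl , q ← neg-code L {pair (suc (index u m w)) (num m)} p
        with ts , refl , m≡ ← rel-code α R {num m}
               (trans (cong (λ i → pair (suc i) (num m)) (sym (num-numeral (w ∷ m ∷ u ∷ []) (relIndex fin R)))) q) =
        sat (B.rel-resp R (entries≈ u m w (ts-value ts s s≋ m≡)) r)

    ⊨clause : A ⊨ᶠᵒ clauseAxioms
    ⊨clause = (λ { _ ([] , _ , _ , _ , ()) }) , ⊨cons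
      where
      ⊨cons : ∀ t h w → relᴰ Clauseᵀ (funᴰ sucˢ (funᴰ pairˢ (h ∷ t ∷ []) ∷ []) ∷ w ∷ []) →
              relᴰ Literalᵀ (h ∷ w ∷ []) ⊎ relᴰ Clauseᵀ (t ∷ w ∷ [])
      ⊨cons t h w (L ∷ ψ , s , s≋ , p , sat)
        with h≡ , t≡ ← pair-injective {num h} {num t} {codeLiteral L} {⟨ map codeLiteral ψ ⟩} (suc-injective p)
        with sat
      ... | here sat′  = inj₁ (L , s , s≋ , h≡ , sat′)
      ... | there sat′ = inj₂ (ψ , s , s≋ , t≡ , sat′)

    -- `Eval` in the expansion yields a genuine run, and the value of a run is unique.
    label≡ : ∀ {σ x n} → T σ → num x ≡ ⟨ σ ⟩ →
             relᴰ (Eval (proj₁ l-computable)) (⌊ suc (pair (num x) 0) ⌋ ∷ n ∷ []) → l σ ≡ num n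
    label≡ {σ} p x≡ e⇓ =
      ⇓-functional (proj₂ l-computable p) (e⇓ (⟨ σ ⟩ ∷ []) (cong (λ k → suc (pair k 0)) x≡))

    -- Outside `T` the program returns 0, which contradicts the recorded value 1.
    in-tree : ∀ {σ x} → num x ≡ ⟨ σ ⟩ →
              relᴰ (Eval (proj₁ T-computable)) (⌊ suc (pair (num x) 0) ⌋ ∷ ⌊ 1 ⌋ ∷ []) → T σ
    in-tree {σ} x≡ e⇓ with proj₂ T-computable σ
    ... | yes p , _  = p
    ... | no _  , e⇓′
      with () ← ⇓-functional e⇓′ (e⇓ (⟨ σ ⟩ ∷ []) (cong (λ k → suc (pair k 0)) x≡))

    module _ {σ} {s : ℕ → B.Carrier} (p : T σ) where
      SatAt : ∀ ρ → (ℕ → B.Carrier) → Set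
      SatAt ρ t = Σ[ q ∈ T ρ ] Σ[ a ∈ Acc ChildOf ρ ] Sat B t (decodeAt q a)

      -- This and the next three lemmas invert satisfaction at a node whose label code is known.
      -- Matching on `acc` and on `node p` lets `decodeAt` reduce, and `labelled` excludes the other
      -- kinds of node.
      leaf-sat : ∀ a {c} → l σ ≡ pair 0 c → Sat B s (decodeAt p a) →
                 ∃[ ψ ] c ≡ ⟨ map codeLiteral ψ ⟩ × Any (LiteralSat B s) ψ
      leaf-sat (acc rs) {c} l≡ sat with node p | labelled 0 c (node p) l≡ | sat
      ... | leaf ψ _ _ _ | _ , c≡ | sat′ = ψ , sym c≡ , sat′
      ... | ex _ _ _ _   | () , _ | _
      ... | all _ _ _ _  | () , _ | _
      ... | conj _ _     | () , _ | _
      ... | disj _ _     | () , _ | _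

      ex-sat : ∀ a {i} → l σ ≡ pair 1 i → Sat B s (decodeAt p a) →
               ∃[ b ] SatAt (σ ∷ʳ 0) (s [ i ≔ b ])
      ex-sat (acc rs) {i} l≡ sat with node p | labelled 1 i (node p) l≡ | sat
      ... | leaf _ _ _ _ | () , _ | _
      ... | ex _ child _ _ | _ , refl | (b , sat′) =
        b , Equivalence.from (child 0) refl ,
          rs (0 , refl , Equivalence.from (child 0) refl) , sat′
      ... | all _ _ _ _  | () , _ | _
      ... | conj _ _     | () , _ | _
      ... | disj _ _     | () , _ | _

      all-sat : ∀ a {i} → l σ ≡ pair 2 i → Sat B s (decodeAt p a) →
                ∀ b → SatAt (σ ∷ʳ 0) (s [ i ≔ b ])
      all-sat (acc rs) {i} l≡ sat with node p | labelled 2 i (node p) l≡ | sat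
      ... | leaf _ _ _ _ | () , _ | _
      ... | ex _ _ _ _   | () , _ | _
      ... | all _ child _ _ | _ , refl | sat′ = λ b →
        Equivalence.from (child 0) refl , rs (0 , refl , Equivalence.from (child 0) refl) , sat′ b
      ... | conj _ _     | () , _ | _
      ... | disj _ _     | () , _ | _

      conj-sat : ∀ a → l σ ≡ pair 3 0 → Sat B s (decodeAt p a) →
                 ∀ i → T (σ ∷ʳ i) → SatAt (σ ∷ʳ i) s
      conj-sat (acc rs) l≡ sat with node p | labelled 3 0 (node p) l≡ | sat
      ... | leaf _ _ _ _ | () , _ | _
      ... | ex _ _ _ _   | () , _ | _
      ... | all _ _ _ _  | () , _ | _
      ... | conj _ _     | _ | sat′ = λ i q → q , rs (i , refl , q) , sat′ i q
      ... | disj _ _     | () , _ | _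

    -- The hypothesis on `B` enters at the root, under the assignment `env w`; the remaining axioms
    -- pass from a node to its children by the inversion lemmas.
    ⊨node : B ⊨ decode → A ⊨ᶠᵒ nodeAxioms (proj₁ T-computable) (proj₁ l-computable)
    ⊨node B⊨ =
      (λ w → [] , env w , (λ _ → ≈ᴮ.refl) , refl , root , wellFounded [] , B⊨ (env w)) ,
      (λ c x w (σ , s , s≋ , x≡ , p , a , sat) L →
        let (ψ , c≡ , satψ) = leaf-sat p a (label≡ {x = x} {⌊ pair 0 (num c) ⌋} p x≡ L) sat
        in ψ , s , s≋ , c≡ , satψ) ,
      (λ y i x w (σ , s , s≋ , x≡ , p , a , sat) L child →
        let (b , sat′) = ex-sat p a (label≡ {x = x} {⌊ pair 1 (num i) ⌋} p x≡ L) sat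
        -- The witness `b` is represented by the constant sequence with number 0, its copy in
        -- `Domain`.
        in (0 , const b) , (refl , λ _ → ≈ᴮ.refl) ,
           (σ ∷ʳ 0 , s [ num i ≔ b ] , update-cong (num i) s≋ ≈ᴮ.refl , child σ x≡ , sat′)) ,
      (λ y i x w (σ , s , s≋ , x≡ , p , a , sat) L child b →
        σ ∷ʳ 0 , s [ num i ≔ el b ] , update-cong (num i) s≋ ≈ᴮ.refl , child σ x≡ ,
        all-sat p a (label≡ {x = x} {⌊ pair 2 (num i) ⌋} p x≡ L) sat (el b)) ,
      (λ y i x w (σ , s , s≋ , x≡ , p , a , sat) L child y∈T →
        σ ∷ʳ num i , s , s≋ , child σ x≡ ,
        conj-sat p a (label≡ {x = x} {⌊ pair 3 0 ⌋} p x≡ L) sat (num i) (in-tree {x = y} (child σ x≡) y∈T))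

    expands : B ⊨ decode → A ⊨ᶠᵒ φ
    expands B⊨ =
      ⊨list , ⊨pair , ⊨rec (proj₁ T-computable) , ⊨rec (proj₁ l-computable) ,
      ⊨snoc , ⊨term , ⊨eq , ⊨clause , ⊨node B⊨ ,
      ⋀-intro (⊨fun ∘ Inverse.from (fun-enum fin)) , ⋀-intro (⊨rel ∘ Inverse.from (rel-enum fin))

-- Both directions combined: expansion gives the structure, reflection the converse.

theorem1p4 : ∀ {k} (τ : Language) (fin : IsFinite τ) (K : Pred (Structure τ) k) →
    AxiomatizedByComputable⋀⋀ fin K → IsPC′ K
theorem1p4 τ fin K axiomatized = record
  { τ*  = τ⁺
  ; τ⊆  = τ⊆τ⁺
  ; P   = Domain
  ; P∉τ = λ _ ()
  ; φ   = φ
  ; characterizes = λ B → mk⇔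
      (λ KB → let open Expansion B in
        A , expands (Equivalence.to (axiomatizes B) KB) , domain , isomorphism)
      (λ (A , A⊨φ , d , iso) →
        Equivalence.from (axiomatizes B) (Reflection.reflects A A⊨φ d B iso sentence no⋁⋁))
  }
  where
  open AxiomatizedByComputable⋀⋀ axiomatized
  open Vocabulary τ
  open Correctness fin code computable
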